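{- Let $F$ be a Horn formula and let $G$ be a first-order formula such that $F \models G$. Then there exists a Craig-Lyndon interpolant $H$ of $F$ and $G$ that is a Horn formula. Moreover, $H$ can be effectively constructed from a clausal tableau proof of $F \models G$.
   Context: A Horn clause is a clause (disjunction of literals) with at most one positive literal. A Horn formula is a first-order formula built up from Horn clauses with the connectives $\land$, $\exists$ and $\forall$. For a formula $F$, $\mathrm{var}(F)$ is its set of free variables and $\mathrm{voc}(F)$ is the set of function symbols (including constants) occurring in $F$ together with all pairs $\langle p,\mathit{pol}\rangle$, $\mathit{pol}\in\{+,-\}$, such that an atom with predicate $p$ occurs in $F$ with positive (even number of enclosing negations) resp. negative (odd number) polarity. For $F\models G$, a Craig-Lyndon interpolant of $F$ and $G$ is a formula $H$ with $F\models H$, $H\models G$, $\mathrm{voc}(H)\subseteq\mathrm{voc}(F)\cap\mathrm{voc}(G)$ and $\mathrm{var}(H)\subseteq\mathrm{var}(F)\cap\mathrm{var}(G)$. A clausal tableau proof of $F\models G$ is a closed clausal tableau (a finite ordered tree whose non-root nodes are labeled with literals such that the literals of the children of each node form an instance of a clause, every branch containing complementary literals) for the clausal form, after Skolemization, of $F\land\lnot G$. -}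

module Defs where

open import Level using (0ℓ)
open import Data.Nat using (ℕ; zero; suc; _+_; _≤_; _≡ᵇ_)
open import Data.Bool using (Bool; true; false; not; if_then_else_)
open import Data.List using (List; []; _∷_; map; _++_; concatMap)
open import Data.List.Relation.Unary.Any using (Any)
open import Data.List.Relation.Unary.All using (All)
open import Data.List.Membership.Propositional using (_∈_)
open import Data.Product using (Σ; _×_; _,_; proj₁)
open import Data.Sum using (_⊎_)
open import Data.Empty using (⊥)
open import Data.Unit using (⊤)
open import Relation.Binary.PropositionalEquality using (_≡_; _≢_)

Var : Set
Var = ℕ

Fun : Set
Fun = ℕ

Pred : Set
Pred = ℕ

data Term : Set where
  var : Var → Term
  fun : Fun → List Term → Term      -- constants: fun c []

data Formula : Set where
  atom : Pred → List Term → Formula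
  ⊤'   : Formula
  ⊥'   : Formula
  ¬'_  : Formula → Formula
  _∧'_ : Formula → Formula → Formula
  _∨'_ : Formula → Formula → Formula
  _⇒'_ : Formula → Formula → Formula
  ∀'   : Var → Formula → Formula
  ∃'   : Var → Formula → Formula

data FreeT (x : Var) : Term → Set where
  here : FreeT x (var x)
  arg  : ∀ {f ts} → Any (FreeT x) ts → FreeT x (fun f ts)

data FreeIn (x : Var) : Formula → Set where
  atm : ∀ {p ts} → Any (FreeT x) ts → FreeIn x (atom p ts)
  neg : ∀ {A} → FreeIn x A → FreeIn x (¬' A)
  andl : ∀ {A B} → FreeIn x A → FreeIn x (A ∧' B)
  andr : ∀ {A B} → FreeIn x B → FreeIn x (A ∧' B)
  orl : ∀ {A B} → FreeIn x A → FreeIn x (A ∨' B)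
  orr : ∀ {A B} → FreeIn x B → FreeIn x (A ∨' B)
  impl : ∀ {A B} → FreeIn x A → FreeIn x (A ⇒' B)
  impr : ∀ {A B} → FreeIn x B → FreeIn x (A ⇒' B)
  all : ∀ {y A} → x ≢ y → FreeIn x A → FreeIn x (∀' y A)
  ex  : ∀ {y A} → x ≢ y → FreeIn x A → FreeIn x (∃' y A)

data FunT (f : Fun) : Term → Set where
  here : ∀ {ts} → FunT f (fun f ts)
  arg  : ∀ {g ts} → Any (FunT f) ts → FunT f (fun g ts)

data FunIn (f : Fun) : Formula → Set where
  atm : ∀ {p ts} → Any (FunT f) ts → FunIn f (atom p ts)
  neg : ∀ {A} → FunIn f A → FunIn f (¬' A)
  andl : ∀ {A B} → FunIn f A → FunIn f (A ∧' B)
  andr : ∀ {A B} → FunIn f B → FunIn f (A ∧' B)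
  orl : ∀ {A B} → FunIn f A → FunIn f (A ∨' B)
  orr : ∀ {A B} → FunIn f B → FunIn f (A ∨' B)
  impl : ∀ {A B} → FunIn f A → FunIn f (A ⇒' B)
  impr : ∀ {A B} → FunIn f B → FunIn f (A ⇒' B)
  all : ∀ {y A} → FunIn f A → FunIn f (∀' y A)
  ex  : ∀ {y A} → FunIn f A → FunIn f (∃' y A)

data Polarity : Set where
  pos neg : Polarity

flip : Polarity → Polarity
flip pos = neg
flip neg = pos

data PredIn (p : Pred) : Polarity → Formula → Set where
  atm : ∀ {ts} → PredIn p pos (atom p ts)
  neg : ∀ {pol A} → PredIn p pol A → PredIn p (flip pol) (¬' A)
  andl : ∀ {pol A B} → PredIn p pol A → PredIn p pol (A ∧' B)
  andr : ∀ {pol A B} → PredIn p pol B → PredIn p pol (A ∧' B)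
  orl : ∀ {pol A B} → PredIn p pol A → PredIn p pol (A ∨' B)
  orr : ∀ {pol A B} → PredIn p pol B → PredIn p pol (A ∨' B)
  impl : ∀ {pol A B} → PredIn p pol A → PredIn p (flip pol) (A ⇒' B)
  impr : ∀ {pol A B} → PredIn p pol B → PredIn p pol (A ⇒' B)
  all : ∀ {pol y A} → PredIn p pol A → PredIn p pol (∀' y A)
  ex  : ∀ {pol y A} → PredIn p pol A → PredIn p pol (∃' y A)

-- Semantics (Tarskian; classical once excluded middle is assumed)

record Structure : Set₁ where
  field
    D     : Set
    elem  : D                         -- domains are nonempty
    funI  : Fun → List D → D
    predI : Pred → List D → Set

module _ (M : Structure) where
  open Structure M

  update : (Var → D) → Var → D → Var → D
  update ρ x d y = if y ≡ᵇ x then d else ρ y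

  mutual
    evalT : (Var → D) → Term → D
    evalT ρ (var x) = ρ x
    evalT ρ (fun f ts) = funI f (evalTs ρ ts)

    evalTs : (Var → D) → List Term → List D
    evalTs ρ [] = []
    evalTs ρ (t ∷ ts) = evalT ρ t ∷ evalTs ρ ts

  Sat : (Var → D) → Formula → Set
  Sat ρ (atom p ts) = predI p (evalTs ρ ts)
  Sat ρ ⊤' = ⊤
  Sat ρ ⊥' = ⊥
  Sat ρ (¬' A) = Sat ρ A → ⊥
  Sat ρ (A ∧' B) = Sat ρ A × Sat ρ B
  Sat ρ (A ∨' B) = Sat ρ A ⊎ Sat ρ B
  Sat ρ (A ⇒' B) = Sat ρ A → Sat ρ B
  Sat ρ (∀' x A) = (d : D) → Sat (update ρ x d) A
  Sat ρ (∃' x A) = Σ D λ d → Sat (update ρ x d) A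

_⊨_ : Formula → Formula → Set₁
F ⊨ G = (M : Structure) (ρ : Var → Structure.D M) → Sat M ρ F → Sat M ρ G

data Clause : Formula → ℕ → Set where
  empty : Clause ⊥' 0
  posL  : ∀ {p ts} → Clause (atom p ts) 1
  negL  : ∀ {p ts} → Clause (¬' atom p ts) 0
  disj  : ∀ {A B m n} → Clause A m → Clause B n → Clause (A ∨' B) (m + n)

HornClause : Formula → Set
HornClause C = Σ ℕ λ n → Clause C n × n ≤ 1

data IsHorn : Formula → Set where
  clause : ∀ {C} → HornClause C → IsHorn C
  truth  : IsHorn ⊤'                -- empty conjunction
  conj   : ∀ {A B} → IsHorn A → IsHorn B → IsHorn (A ∧' B)
  all    : ∀ {x A} → IsHorn A → IsHorn (∀' x A)
  ex     : ∀ {x A} → IsHorn A → IsHorn (∃' x A)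

record Interpolant (F G H : Formula) : Set₁ where
  field
    F⊨H  : F ⊨ H
    H⊨G  : H ⊨ G
    funs : ∀ f → FunIn f H → FunIn f F × FunIn f G
    preds : ∀ p pol → PredIn p pol H → PredIn p pol F × PredIn p pol G
    vars : ∀ x → FreeIn x H → FreeIn x F × FreeIn x G

data CFun : Set where
  orig : Fun → CFun
  sk   : ℕ → CFun

-- clause terms: clause variables (implicitly universally quantified per
-- clause), parameters (free variables of F ∧ ¬G, rigid), function terms
data CTerm : Set where
  cvar  : ℕ → CTerm
  param : Var → CTerm
  cfun  : CFun → List CTerm → CTerm

record Literal : Set where
  constructor lit
  field
    sign : Bool          -- true = positive
    pred : Pred
    args : List CTerm

CClause : Set
CClause = List Literal

mutual
  trT : (Var → CTerm) → Term → CTerm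
  trT e (var x) = e x
  trT e (fun f ts) = cfun (orig f) (trTs e ts)

  trTs : (Var → CTerm) → List Term → List CTerm
  trTs e [] = []
  trTs e (t ∷ ts) = trT e t ∷ trTs e ts

upd : (Var → CTerm) → Var → CTerm → Var → CTerm
upd e x t y = if y ≡ᵇ x then t else e y

cross : List CClause → List CClause → List CClause
cross cs ds = concatMap (λ c → map (λ d → c ++ d) ds) cs

-- cl e us c b A : clauses of A (if b = true) or of ¬A (if b = false),
-- with negation normal form, Skolemization (Skolem terms applied to the
-- universally quantified clause variables in scope, us) and conversion
-- to CNF by distribution; c is a counter for fresh variables/Skolem symbols
cl : (Var → CTerm) → List ℕ → ℕ → Bool → Formula → List CClause × ℕ
conjC disjC : (Var → CTerm) → List ℕ → ℕ → Bool → Formula → Bool → Formula → List CClause × ℕ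
cl e us c b (atom p ts) = ((lit b p (trTs e ts) ∷ []) ∷ [] , c)
cl e us c true ⊤' = ([] , c)
cl e us c false ⊤' = ([] ∷ [] , c)
cl e us c true ⊥' = ([] ∷ [] , c)
cl e us c false ⊥' = ([] , c)
cl e us c b (¬' A) = cl e us c (not b) A
cl e us c true (A ∧' B) = conjC e us c true A true B
cl e us c false (A ∧' B) = disjC e us c false A false B
cl e us c true (A ∨' B) = disjC e us c true A true B
cl e us c false (A ∨' B) = conjC e us c false A false B
cl e us c true (A ⇒' B) = disjC e us c false A true B
cl e us c false (A ⇒' B) = conjC e us c true A false B
cl e us c true (∀' x A) = cl (upd e x (cvar c)) (c ∷ us) (suc c) true A
cl e us c false (∀' x A) = cl (upd e x (cfun (sk c) (map cvar us))) us (suc c) false A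
cl e us c true (∃' x A) = cl (upd e x (cfun (sk c) (map cvar us))) us (suc c) true A
cl e us c false (∃' x A) = cl (upd e x (cvar c)) (c ∷ us) (suc c) false A

conjC e us c b A b' B with cl e us c b A
... | (cA , c1) with cl e us c1 b' B
... | (cB , c2) = (cA ++ cB , c2)
disjC e us c b A b' B with cl e us c b A
... | (cA , c1) with cl e us c1 b' B
... | (cB , c2) = (cross cA cB , c2)

clausalForm : Formula → Formula → List CClause
clausalForm F G = proj₁ (cl param [] 0 true (F ∧' (¬' G)))

mutual
  substT : (ℕ → CTerm) → CTerm → CTerm
  substT σ (cvar n) = σ n
  substT σ (param x) = param x
  substT σ (cfun f ts) = cfun f (substTs σ ts)

  substTs : (ℕ → CTerm) → List CTerm → List CTerm
  substTs σ [] = []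
  substTs σ (t ∷ ts) = substT σ t ∷ substTs σ ts

instLit : (ℕ → CTerm) → Literal → Literal
instLit σ (lit s p ts) = lit s p (substTs σ ts)

Complementary : List Literal → Set
Complementary br = Σ Pred λ p → Σ (List CTerm) λ ts →
  (lit true p ts ∈ br) × (lit false p ts ∈ br)

-- Tableau S br : a finite ordered tree below a node whose branch (from the
-- root) is br, in which the children of every inner node form an instance
-- of a clause of S, and every branch is closed
data Tableau (S : List CClause) (br : List Literal) : Set where
  close  : Complementary br → Tableau S br
  extend : (C : CClause) → C ∈ S → (σ : ℕ → CTerm) →
           All (λ L → Tableau S (L ∷ br)) (map (instLit σ) C) →
           Tableau S br

ClosedTableau : List CClause → Set
ClosedTableau S = Tableau S []

TableauProof : Formula → Formula → Set
TableauProof F G = ClosedTableau (clausalForm F G)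

{-# OPTIONS --safe #-}
-- The clause instances used by the tableau split into ground instances of F, which are Horn, and of ¬G.
-- Call a ground atom shared with sign s if it occurs with sign s in the former and with the opposite sign
-- in the latter. The ground interpolant is the conjunction of all Horn clauses over shared literals that the
-- instances of F entail, a finite check. To see that it contradicts the instances of ¬G, suppose a valuation v
-- satisfies both; the consequences of the F-instances and of the shared premises true in v form a model w of
-- the F-instances. Following, in the tableau, literals true in w at F-clauses and true in v at G-clauses leads
-- to a closed branch, but v and w cannot disagree on a shared atom in the way that closure requires.
--
-- The ground interpolant is lifted by replacing each term whose root symbol is not common to F and G by a
-- variable: existential, unless the symbol belongs to G only, when it is universal. Subterms are quantified before
-- superterms. In a model of F the existential witness is the value of the replaced term, computed with the
-- values chosen for the universal variables; dually for ¬G.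
--
-- If F ⊨ G but there is no closed tableau, extending an open branch by every clause instance in turn yields
-- an infinite open branch, which defines a Herbrand model of F and ¬G.

module Submission where

open import Defs
open import Level using (0ℓ)
open import Axiom.ExcludedMiddle using (ExcludedMiddle)
open import Data.Bool using (Bool; true; false; not; if_then_else_; T)
open import Data.Empty using (⊥; ⊥-elim)
open import Data.List using (List; []; _∷_; map; _++_; concat; concatMap; filter; foldr; cartesianProduct; _ʳ++_)
open import Data.List.Properties using (∷-injectiveˡ; ∷-injectiveʳ)
open import Data.List.Membership.Propositional using (_∈_; _∉_; find; lose)
open import Data.List.Membership.Propositional.Properties
open import Data.List.Relation.Unary.All as All using (All; []; _∷_)
open import Data.List.Relation.Unary.AllPairs using (AllPairs; []; _∷_)
open import Data.List.Relation.Unary.Any as Any using (Any; here; there)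
open import Data.Maybe using (Maybe; just; nothing)
open import Data.Nat using (ℕ; zero; suc; _+_; _*_; _≤_; _<_; _≤′_; ≤′-refl; ≤′-step; _⊔_; _≡ᵇ_; z≤n; s≤s)
open import Data.Nat.Properties
open import Data.Product using (Σ; _×_; _,_; proj₁; proj₂)
open import Data.Sum using (_⊎_; inj₁; inj₂)
open import Data.Unit using (⊤; tt)
open import Function using (_∘_; id)
open import Relation.Binary.Definitions using (DecidableEquality; tri<; tri≈; tri>)
open import Relation.Binary.PropositionalEquality using (_≡_; _≢_; refl; sym; trans; cong; cong₂; subst)
open import Relation.Unary using (Decidable)
open import Relation.Nullary using (¬_; Dec; yes; no; does)
open import Relation.Nullary.Decidable using (map′; decidable-stable; _→-dec_; ¬?)
import Data.List.Membership.DecPropositional as DecMembership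
import Data.List.Relation.Unary.Any.Properties as Anyₚ
import Data.List.Relation.Unary.All.Properties as Allₚ

-- Gödel numbering of clause terms

-- This is 2^a (2b + 1). It is injective, never 0, and exceeds both arguments, so a compound gets a
-- larger code than its components.
pair : ℕ → ℕ → ℕ
pair zero    b = suc (2 * b)
pair (suc a) b = 2 * pair a b

pair-injective : ∀ a b a′ b′ → pair a b ≡ pair a′ b′ → a ≡ a′ × b ≡ b′
pair-injective zero b zero b′ eq = refl , *-cancelˡ-≡ b b′ 2 (suc-injective eq)
pair-injective zero b (suc a′) b′ eq = ⊥-elim (even≢odd (pair a′ b′) b (sym eq))
pair-injective (suc a) b zero b′ eq = ⊥-elim (even≢odd (pair a b) b′ eq)
pair-injective (suc a) b (suc a′) b′ eq
  with refl , b≡b′ ← pair-injective a b a′ b′ (*-cancelˡ-≡ (pair a b) (pair a′ b′) 2 eq) = refl , b≡b′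

fst<pair : ∀ a b → a < pair a b
fst<pair zero b = s≤s z≤n
fst<pair (suc a) b = ≤-trans (+-mono-≤ (≤-trans (s≤s z≤n) lt) lt) (+-monoʳ-≤ (pair a b) (m≤m+n (pair a b) 0))
  where lt = fst<pair a b

snd<pair : ∀ a b → b < pair a b
snd<pair zero b = s≤s (m≤m+n b (b + 0))
snd<pair (suc a) b = ≤-trans (snd<pair a b) (m≤m+n (pair a b) _)

codeFun : CFun → ℕ
codeFun (orig f) = 2 * f
codeFun (sk n)   = suc (2 * n)

codeFun-injective : ∀ f g → codeFun f ≡ codeFun g → f ≡ g
codeFun-injective (orig f) (orig g) eq = cong orig (*-cancelˡ-≡ f g 2 eq)
codeFun-injective (orig f) (sk n) eq = ⊥-elim (even≢odd f n eq)
codeFun-injective (sk m) (orig g) eq = ⊥-elim (even≢odd g m (sym eq))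
codeFun-injective (sk m) (sk n) eq = cong sk (*-cancelˡ-≡ m n 2 (suc-injective eq))

mutual
  -- The tags 0, 1 and at least 2 separate the three kinds of term. The value 0 is free for the
  -- empty list because `pair` is positive.
  code : CTerm → ℕ
  code (cvar n)    = pair 0 n
  code (param x)   = pair 1 x
  code (cfun f ts) = pair (suc (suc (codeFun f))) (codes ts)

  codes : List CTerm → ℕ
  codes []       = 0
  codes (t ∷ ts) = pair (code t) (codes ts)

mutual
  code-injective : ∀ s t → code s ≡ code t → s ≡ t
  code-injective (cvar m) (cvar n) eq = cong cvar (proj₂ (pair-injective 0 m 0 n eq))
  code-injective (cvar m) (param y) eq with () ← proj₁ (pair-injective 0 m 1 y eq)
  code-injective (cvar m) (cfun g us) eq with () ← proj₁ (pair-injective 0 m (suc (suc (codeFun g))) (codes us) eq)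
  code-injective (param x) (cvar n) eq with () ← proj₁ (pair-injective 1 x 0 n eq)
  code-injective (param x) (param y) eq = cong param (proj₂ (pair-injective 1 x 1 y eq))
  code-injective (param x) (cfun g us) eq with () ← proj₁ (pair-injective 1 x (suc (suc (codeFun g))) (codes us) eq)
  code-injective (cfun f ts) (cvar n) eq with () ← proj₁ (pair-injective (suc (suc (codeFun f))) (codes ts) 0 n eq)
  code-injective (cfun f ts) (param y) eq with () ← proj₁ (pair-injective (suc (suc (codeFun f))) (codes ts) 1 y eq)
  code-injective (cfun f ts) (cfun g us) eq
    with p , q ← pair-injective (suc (suc (codeFun f))) (codes ts) (suc (suc (codeFun g))) (codes us) eq
    = cong₂ cfun (codeFun-injective f g (suc-injective (suc-injective p))) (codes-injective ts us q)

  codes-injective : ∀ ss ts → codes ss ≡ codes ts → ss ≡ ts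
  codes-injective [] [] eq = refl
  codes-injective [] (t ∷ ts) eq = ⊥-elim (n≮0 (subst (_ <_) (sym eq) (fst<pair (code t) (codes ts))))
  codes-injective (s ∷ ss) [] eq = ⊥-elim (n≮0 (subst (_ <_) eq (fst<pair (code s) (codes ss))))
  codes-injective (s ∷ ss) (t ∷ ts) eq
    with p , q ← pair-injective (code s) (codes ss) (code t) (codes ts) eq
    = cong₂ _∷_ (code-injective s t p) (codes-injective ss ts q)

Atom : Set
Atom = Pred × List CTerm

literal : Bool → Atom → Literal
literal s (p , ts) = lit s p ts

atomOf : Literal → Atom
atomOf (lit _ p ts) = p , ts

codeAtom : Atom → ℕ
codeAtom (p , ts) = pair p (codes ts)

codeAtom-injective : ∀ a b → codeAtom a ≡ codeAtom b → a ≡ b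
codeAtom-injective (p , ts) (q , us) eq
  with p≡q , e ← pair-injective p (codes ts) q (codes us) eq = cong₂ _,_ p≡q (codes-injective ts us e)

codeLit : Literal → ℕ
codeLit L = pair (if Literal.sign L then 0 else 1) (codeAtom (atomOf L))

codeLit-injective : ∀ K L → codeLit K ≡ codeLit L → K ≡ L
codeLit-injective (lit true p ts) (lit true q us) eq
  with refl ← codeAtom-injective (p , ts) (q , us) (proj₂ (pair-injective 0 (pair p (codes ts)) 0 (pair q (codes us)) eq)) = refl
codeLit-injective (lit true p ts) (lit false q us) eq with () ← proj₁ (pair-injective 0 (pair p (codes ts)) 1 (pair q (codes us)) eq)
codeLit-injective (lit false p ts) (lit true q us) eq with () ← proj₁ (pair-injective 1 (pair p (codes ts)) 0 (pair q (codes us)) eq)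
codeLit-injective (lit false p ts) (lit false q us) eq
  with refl ← codeAtom-injective (p , ts) (q , us) (proj₂ (pair-injective 1 (pair p (codes ts)) 1 (pair q (codes us)) eq)) = refl

codeClause : CClause → ℕ
codeClause []      = 0
codeClause (L ∷ C) = pair (codeLit L) (codeClause C)

codeClause-injective : ∀ C D → codeClause C ≡ codeClause D → C ≡ D
codeClause-injective [] [] eq = refl
codeClause-injective [] (L ∷ D) eq = ⊥-elim (n≮0 (subst (_ <_) (sym eq) (fst<pair (codeLit L) (codeClause D))))
codeClause-injective (K ∷ C) [] eq = ⊥-elim (n≮0 (subst (_ <_) eq (fst<pair (codeLit K) (codeClause C))))
codeClause-injective (K ∷ C) (L ∷ D) eq
  with p , q ← pair-injective (codeLit K) (codeClause C) (codeLit L) (codeClause D) eq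
  = cong₂ _∷_ (codeLit-injective K L p) (codeClause-injective C D q)

_≟ᵗ_ : DecidableEquality CTerm
s ≟ᵗ t = map′ (code-injective s t) (cong code) (code s ≟ code t)

_≟ᵃ_ : DecidableEquality Atom
a ≟ᵃ b = map′ (codeAtom-injective a b) (cong codeAtom) (codeAtom a ≟ codeAtom b)

_≟ˡ_ : DecidableEquality Literal
K ≟ˡ L = map′ (codeLit-injective K L) (cong codeLit) (codeLit K ≟ codeLit L)

mutual
  subterms : CTerm → List CTerm
  subterms (cvar n)    = cvar n ∷ []
  subterms (param x)   = param x ∷ []
  subterms (cfun f ts) = cfun f ts ∷ subtermss ts

  subtermss : List CTerm → List CTerm
  subtermss []       = []
  subtermss (t ∷ ts) = subterms t ++ subtermss ts

mutual
  -- Comparing codes therefore extends the subterm order to a linear order. The quantifier prefix is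
  -- sorted by it.
  code-subterm : ∀ {s} t → s ∈ subterms t → code s ≤ code t
  code-subterm (cvar n) (here refl) = ≤-refl
  code-subterm (param x) (here refl) = ≤-refl
  code-subterm (cfun f ts) (here refl) = ≤-refl
  code-subterm (cfun f ts) (there m) =
    <⇒≤ (<-trans (code-subterms ts m) (snd<pair (suc (suc (codeFun f))) (codes ts)))

  code-subterms : ∀ {s} ts → s ∈ subtermss ts → code s < codes ts
  code-subterms (t ∷ ts) m with ∈-++⁻ (subterms t) m
  ... | inj₁ m′ = ≤-<-trans (code-subterm t m′) (fst<pair (code t) (codes ts))
  ... | inj₂ m′ = <-trans (code-subterms ts m′) (snd<pair (code t) (codes ts))

-- Symbols of clause terms

data Sym : Set where
  cv : ℕ → Sym
  pa : Var → Sym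
  fn : CFun → Sym

-- An embedding into clause terms, through which symbols inherit decidable equality.
bare : Sym → CTerm
bare (cv n) = cvar n
bare (pa x) = param x
bare (fn f) = cfun f []

bare-injective : ∀ r r′ → bare r ≡ bare r′ → r ≡ r′
bare-injective (cv n) (cv _) refl = refl
bare-injective (pa x) (pa _) refl = refl
bare-injective (fn f) (fn _) refl = refl

_≟ˢ_ : DecidableEquality Sym
r ≟ˢ r′ = map′ (bare-injective r r′) (cong bare) (bare r ≟ᵗ bare r′)

root : CTerm → Sym
root (cvar n)   = cv n
root (param x)  = pa x
root (cfun f _) = fn f

mutual
  symsT : CTerm → List Sym
  symsT (cvar n)    = cv n ∷ []
  symsT (param x)   = pa x ∷ []
  symsT (cfun f ts) = fn f ∷ symsTs ts

  symsTs : List CTerm → List Sym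
  symsTs []       = []
  symsTs (t ∷ ts) = symsT t ++ symsTs ts

symsL : Literal → List Sym
symsL (lit _ _ ts) = symsTs ts

symsS : List CClause → List Sym
symsS = concatMap (concatMap symsL)

symsS⁺ : ∀ {S C L r} → C ∈ S → L ∈ C → r ∈ symsL L → r ∈ symsS S
symsS⁺ C∈S L∈C r∈L =
  Anyₚ.concatMap⁺ (concatMap symsL) (lose C∈S (Anyₚ.concatMap⁺ symsL (lose L∈C r∈L)))

symsS⁻ : ∀ S {r} → r ∈ symsS S → Σ CClause λ C → C ∈ S × Σ Literal λ L → L ∈ C × r ∈ symsL L
symsS⁻ S r∈ with C , C∈S , r∈C ← find (Anyₚ.concatMap⁻ (concatMap symsL) r∈)
  = C , C∈S , find (Anyₚ.concatMap⁻ symsL r∈C)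

symsTs-map-cvar : ∀ us {r} → r ∈ symsTs (map cvar us) → Σ ℕ λ n → n ∈ us × r ≡ cv n
symsTs-map-cvar (u ∷ us) (here refl) = u , here refl , refl
symsTs-map-cvar (u ∷ us) (there r∈) with n , n∈ , eq ← symsTs-map-cvar us r∈ = n , there n∈ , eq

-- Negation normal form

data NNF : Formula → Set where
  posA : ∀ {p ts} → NNF (atom p ts)
  negA : ∀ {p ts} → NNF (¬' atom p ts)
  top  : NNF ⊤'
  bot  : NNF ⊥'
  and  : ∀ {A B} → NNF A → NNF B → NNF (A ∧' B)
  or   : ∀ {A B} → NNF A → NNF B → NNF (A ∨' B)
  all  : ∀ {x A} → NNF A → NNF (∀' x A)
  ex   : ∀ {x A} → NNF A → NNF (∃' x A)

nnf : Bool → Formula → Formula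
nnf true  (atom p ts) = atom p ts
nnf false (atom p ts) = ¬' atom p ts
nnf true  ⊤'          = ⊤'
nnf false ⊤'          = ⊥'
nnf true  ⊥'          = ⊥'
nnf false ⊥'          = ⊤'
nnf b     (¬' A)      = nnf (not b) A
nnf true  (A ∧' B)    = nnf true A ∧' nnf true B
nnf false (A ∧' B)    = nnf false A ∨' nnf false B
nnf true  (A ∨' B)    = nnf true A ∨' nnf true B
nnf false (A ∨' B)    = nnf false A ∧' nnf false B
nnf true  (A ⇒' B)    = nnf false A ∨' nnf true B
nnf false (A ⇒' B)    = nnf true A ∧' nnf false B
nnf true  (∀' x A)    = ∀' x (nnf true A)
nnf false (∀' x A)    = ∃' x (nnf false A)
nnf true  (∃' x A)    = ∃' x (nnf true A)
nnf false (∃' x A)    = ∀' x (nnf false A)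

nnf-NNF : ∀ b A → NNF (nnf b A)
nnf-NNF true  (atom p ts) = posA
nnf-NNF false (atom p ts) = negA
nnf-NNF true  ⊤'          = top
nnf-NNF false ⊤'          = bot
nnf-NNF true  ⊥'          = bot
nnf-NNF false ⊥'          = top
nnf-NNF true  (¬' A)      = nnf-NNF false A
nnf-NNF false (¬' A)      = nnf-NNF true A
nnf-NNF true  (A ∧' B)    = and (nnf-NNF true A) (nnf-NNF true B)
nnf-NNF false (A ∧' B)    = or (nnf-NNF false A) (nnf-NNF false B)
nnf-NNF true  (A ∨' B)    = or (nnf-NNF true A) (nnf-NNF true B)
nnf-NNF false (A ∨' B)    = and (nnf-NNF false A) (nnf-NNF false B)
nnf-NNF true  (A ⇒' B)    = or (nnf-NNF false A) (nnf-NNF true B)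
nnf-NNF false (A ⇒' B)    = and (nnf-NNF true A) (nnf-NNF false B)
nnf-NNF true  (∀' x A)    = all (nnf-NNF true A)
nnf-NNF false (∀' x A)    = ex (nnf-NNF false A)
nnf-NNF true  (∃' x A)    = ex (nnf-NNF true A)
nnf-NNF false (∃' x A)    = all (nnf-NNF false A)

conjC-nnf : ∀ e us c b A b′ B →
  cl e us c b A ≡ cl e us c true (nnf b A) → (∀ c → cl e us c b′ B ≡ cl e us c true (nnf b′ B)) →
  conjC e us c b A b′ B ≡ conjC e us c true (nnf b A) true (nnf b′ B)
conjC-nnf e us c b A b′ B p q rewrite p | q (proj₂ (cl e us c true (nnf b A))) = refl

disjC-nnf : ∀ e us c b A b′ B →
  cl e us c b A ≡ cl e us c true (nnf b A) → (∀ c → cl e us c b′ B ≡ cl e us c true (nnf b′ B)) →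
  disjC e us c b A b′ B ≡ disjC e us c true (nnf b A) true (nnf b′ B)
disjC-nnf e us c b A b′ B p q rewrite p | q (proj₂ (cl e us c true (nnf b A))) = refl

-- `nnf` pushes the sign inwards exactly as `cl` does, keeping the order in which the counter is
-- threaded. Later inductions on clausal forms can thus run over `NNF` with sign `true`.
cl-nnf : ∀ b A e us c → cl e us c b A ≡ cl e us c true (nnf b A)
cl-nnf true  (atom p ts) e us c = refl
cl-nnf false (atom p ts) e us c = refl
cl-nnf true  ⊤' e us c = refl
cl-nnf false ⊤' e us c = refl
cl-nnf true  ⊥' e us c = refl
cl-nnf false ⊥' e us c = refl
cl-nnf true  (¬' A) e us c = cl-nnf false A e us c
cl-nnf false (¬' A) e us c = cl-nnf true A e us c
cl-nnf true  (A ∧' B) e us c = conjC-nnf e us c true A true B (cl-nnf true A e us c) (cl-nnf true B e us)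
cl-nnf false (A ∧' B) e us c = disjC-nnf e us c false A false B (cl-nnf false A e us c) (cl-nnf false B e us)
cl-nnf true  (A ∨' B) e us c = disjC-nnf e us c true A true B (cl-nnf true A e us c) (cl-nnf true B e us)
cl-nnf false (A ∨' B) e us c = conjC-nnf e us c false A false B (cl-nnf false A e us c) (cl-nnf false B e us)
cl-nnf true  (A ⇒' B) e us c = disjC-nnf e us c false A true B (cl-nnf false A e us c) (cl-nnf true B e us)
cl-nnf false (A ⇒' B) e us c = conjC-nnf e us c true A false B (cl-nnf true A e us c) (cl-nnf false B e us)
cl-nnf true  (∀' x A) e us c = cl-nnf true A _ _ _
cl-nnf false (∀' x A) e us c = cl-nnf false A _ _ _
cl-nnf true  (∃' x A) e us c = cl-nnf true A _ _ _
cl-nnf false (∃' x A) e us c = cl-nnf false A _ _ _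

FreeIn-nnf : ∀ {x} b A → FreeIn x (nnf b A) → FreeIn x A
FreeIn-nnf true  (atom p ts) i = i
FreeIn-nnf false (atom p ts) (neg i) = i
FreeIn-nnf true  (¬' A) i = neg (FreeIn-nnf false A i)
FreeIn-nnf false (¬' A) i = neg (FreeIn-nnf true A i)
FreeIn-nnf true  (A ∧' B) (andl i) = andl (FreeIn-nnf true A i)
FreeIn-nnf true  (A ∧' B) (andr i) = andr (FreeIn-nnf true B i)
FreeIn-nnf false (A ∧' B) (orl i) = andl (FreeIn-nnf false A i)
FreeIn-nnf false (A ∧' B) (orr i) = andr (FreeIn-nnf false B i)
FreeIn-nnf true  (A ∨' B) (orl i) = orl (FreeIn-nnf true A i)
FreeIn-nnf true  (A ∨' B) (orr i) = orr (FreeIn-nnf true B i)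
FreeIn-nnf false (A ∨' B) (andl i) = orl (FreeIn-nnf false A i)
FreeIn-nnf false (A ∨' B) (andr i) = orr (FreeIn-nnf false B i)
FreeIn-nnf true  (A ⇒' B) (orl i) = impl (FreeIn-nnf false A i)
FreeIn-nnf true  (A ⇒' B) (orr i) = impr (FreeIn-nnf true B i)
FreeIn-nnf false (A ⇒' B) (andl i) = impl (FreeIn-nnf true A i)
FreeIn-nnf false (A ⇒' B) (andr i) = impr (FreeIn-nnf false B i)
FreeIn-nnf true  (∀' y A) (all ne i) = all ne (FreeIn-nnf true A i)
FreeIn-nnf false (∀' y A) (ex ne i) = all ne (FreeIn-nnf false A i)
FreeIn-nnf true  (∃' y A) (ex ne i) = ex ne (FreeIn-nnf true A i)
FreeIn-nnf false (∃' y A) (all ne i) = ex ne (FreeIn-nnf false A i)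

FunIn-nnf : ∀ {f} b A → FunIn f (nnf b A) → FunIn f A
FunIn-nnf true  (atom p ts) i = i
FunIn-nnf false (atom p ts) (neg i) = i
FunIn-nnf true  (¬' A) i = neg (FunIn-nnf false A i)
FunIn-nnf false (¬' A) i = neg (FunIn-nnf true A i)
FunIn-nnf true  (A ∧' B) (andl i) = andl (FunIn-nnf true A i)
FunIn-nnf true  (A ∧' B) (andr i) = andr (FunIn-nnf true B i)
FunIn-nnf false (A ∧' B) (orl i) = andl (FunIn-nnf false A i)
FunIn-nnf false (A ∧' B) (orr i) = andr (FunIn-nnf false B i)
FunIn-nnf true  (A ∨' B) (orl i) = orl (FunIn-nnf true A i)
FunIn-nnf true  (A ∨' B) (orr i) = orr (FunIn-nnf true B i)
FunIn-nnf false (A ∨' B) (andl i) = orl (FunIn-nnf false A i)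
FunIn-nnf false (A ∨' B) (andr i) = orr (FunIn-nnf false B i)
FunIn-nnf true  (A ⇒' B) (orl i) = impl (FunIn-nnf false A i)
FunIn-nnf true  (A ⇒' B) (orr i) = impr (FunIn-nnf true B i)
FunIn-nnf false (A ⇒' B) (andl i) = impl (FunIn-nnf true A i)
FunIn-nnf false (A ⇒' B) (andr i) = impr (FunIn-nnf false B i)
FunIn-nnf true  (∀' y A) (all i) = all (FunIn-nnf true A i)
FunIn-nnf false (∀' y A) (ex i) = all (FunIn-nnf false A i)
FunIn-nnf true  (∃' y A) (ex i) = ex (FunIn-nnf true A i)
FunIn-nnf false (∃' y A) (all i) = ex (FunIn-nnf false A i)

flipUnless : Bool → Polarity → Polarity
flipUnless true  pol = pol
flipUnless false pol = flip pol

flip-flip : ∀ pol → flip (flip pol) ≡ pol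
flip-flip pos = refl
flip-flip neg = refl

PredIn-flip : ∀ {p pol A} → PredIn p (flip (flip pol)) A → PredIn p pol A
PredIn-flip {p} {pol} {A} = subst (λ q → PredIn p q A) (flip-flip pol)

PredIn-nnf : ∀ {p pol} b A → PredIn p pol (nnf b A) → PredIn p (flipUnless b pol) A
PredIn-nnf true  (atom p ts) i = i
PredIn-nnf false (atom p ts) (neg i) = subst (λ q → PredIn _ q _) (sym (flip-flip _)) i
PredIn-nnf true  (¬' A) i = PredIn-flip (neg (PredIn-nnf false A i))
PredIn-nnf false (¬' A) i = neg (PredIn-nnf true A i)
PredIn-nnf true  (A ∧' B) (andl i) = andl (PredIn-nnf true A i)
PredIn-nnf true  (A ∧' B) (andr i) = andr (PredIn-nnf true B i)
PredIn-nnf false (A ∧' B) (orl i) = andl (PredIn-nnf false A i)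
PredIn-nnf false (A ∧' B) (orr i) = andr (PredIn-nnf false B i)
PredIn-nnf true  (A ∨' B) (orl i) = orl (PredIn-nnf true A i)
PredIn-nnf true  (A ∨' B) (orr i) = orr (PredIn-nnf true B i)
PredIn-nnf false (A ∨' B) (andl i) = orl (PredIn-nnf false A i)
PredIn-nnf false (A ∨' B) (andr i) = orr (PredIn-nnf false B i)
PredIn-nnf true  (A ⇒' B) (orl i) = PredIn-flip (impl (PredIn-nnf false A i))
PredIn-nnf true  (A ⇒' B) (orr i) = impr (PredIn-nnf true B i)
PredIn-nnf false (A ⇒' B) (andl i) = impl (PredIn-nnf true A i)
PredIn-nnf false (A ⇒' B) (andr i) = impr (PredIn-nnf false B i)
PredIn-nnf true  (∀' y A) (all i) = all (PredIn-nnf true A i)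
PredIn-nnf false (∀' y A) (ex i) = all (PredIn-nnf false A i)
PredIn-nnf true  (∃' y A) (ex i) = ex (PredIn-nnf true A i)
PredIn-nnf false (∃' y A) (all i) = ex (PredIn-nnf false A i)

SatSign : (M : Structure) → Bool → (Var → Structure.D M) → Formula → Set
SatSign M true  ρ A = Sat M ρ A
SatSign M false ρ A = ¬ Sat M ρ A

module _ (em : ExcludedMiddle 0ℓ) where

  -- Excluded middle serves to remove double negations, to turn implications into disjunctions, and
  -- to negate conjunctions, implications and universal quantifications.
  Sat-nnf⁺ : ∀ M b A {ρ} → SatSign M b ρ A → Sat M ρ (nnf b A)
  Sat-nnf⁺ M true  (atom p ts) s = s
  Sat-nnf⁺ M false (atom p ts) s = s
  Sat-nnf⁺ M true  ⊤' s = s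
  Sat-nnf⁺ M false ⊤' s = s tt
  Sat-nnf⁺ M true  ⊥' s = s
  Sat-nnf⁺ M false ⊥' s = tt
  Sat-nnf⁺ M true  (¬' A) s = Sat-nnf⁺ M false A s
  Sat-nnf⁺ M false (¬' A) s = Sat-nnf⁺ M true A (decidable-stable em s)
  Sat-nnf⁺ M true  (A ∧' B) (s , s′) = Sat-nnf⁺ M true A s , Sat-nnf⁺ M true B s′
  Sat-nnf⁺ M false (A ∧' B) {ρ} s with em {P = Sat M ρ A}
  ... | yes a = inj₂ (Sat-nnf⁺ M false B (λ b → s (a , b)))
  ... | no ¬a = inj₁ (Sat-nnf⁺ M false A ¬a)
  Sat-nnf⁺ M true  (A ∨' B) (inj₁ s) = inj₁ (Sat-nnf⁺ M true A s)
  Sat-nnf⁺ M true  (A ∨' B) (inj₂ s) = inj₂ (Sat-nnf⁺ M true B s)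
  Sat-nnf⁺ M false (A ∨' B) s = Sat-nnf⁺ M false A (s ∘ inj₁) , Sat-nnf⁺ M false B (s ∘ inj₂)
  Sat-nnf⁺ M true  (A ⇒' B) {ρ} s with em {P = Sat M ρ A}
  ... | yes a = inj₂ (Sat-nnf⁺ M true B (s a))
  ... | no ¬a = inj₁ (Sat-nnf⁺ M false A ¬a)
  Sat-nnf⁺ M false (A ⇒' B) s =
    Sat-nnf⁺ M true A (decidable-stable em (λ ¬a → s (⊥-elim ∘ ¬a))) , Sat-nnf⁺ M false B (λ b → s (λ _ → b))
  Sat-nnf⁺ M true  (∀' x A) s d = Sat-nnf⁺ M true A (s d)
  Sat-nnf⁺ M false (∀' x A) {ρ} s
    with d , ¬a ← decidable-stable (em {P = Σ (Structure.D M) λ d → ¬ Sat M (update M ρ x d) A})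
                    (λ n → s (λ d → decidable-stable em (λ ¬a → n (d , ¬a))))
    = d , Sat-nnf⁺ M false A ¬a
  Sat-nnf⁺ M true  (∃' x A) (d , s) = d , Sat-nnf⁺ M true A s
  Sat-nnf⁺ M false (∃' x A) s d = Sat-nnf⁺ M false A (λ a → s (d , a))

Sat-nnf⁻ : ∀ M b A {ρ} → Sat M ρ (nnf b A) → SatSign M b ρ A
Sat-nnf⁻ M true  (atom p ts) s = s
Sat-nnf⁻ M false (atom p ts) s = s
Sat-nnf⁻ M true  ⊤' s = s
Sat-nnf⁻ M false ⊤' s = ⊥-elim s
Sat-nnf⁻ M true  ⊥' s = s
Sat-nnf⁻ M false ⊥' s = id
Sat-nnf⁻ M true  (¬' A) s = Sat-nnf⁻ M false A s
Sat-nnf⁻ M false (¬' A) s = λ ¬a → ¬a (Sat-nnf⁻ M true A s)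
Sat-nnf⁻ M true  (A ∧' B) (s , s′) = Sat-nnf⁻ M true A s , Sat-nnf⁻ M true B s′
Sat-nnf⁻ M false (A ∧' B) (inj₁ s) (a , b) = Sat-nnf⁻ M false A s a
Sat-nnf⁻ M false (A ∧' B) (inj₂ s) (a , b) = Sat-nnf⁻ M false B s b
Sat-nnf⁻ M true  (A ∨' B) (inj₁ s) = inj₁ (Sat-nnf⁻ M true A s)
Sat-nnf⁻ M true  (A ∨' B) (inj₂ s) = inj₂ (Sat-nnf⁻ M true B s)
Sat-nnf⁻ M false (A ∨' B) (s , s′) (inj₁ a) = Sat-nnf⁻ M false A s a
Sat-nnf⁻ M false (A ∨' B) (s , s′) (inj₂ b) = Sat-nnf⁻ M false B s′ b
Sat-nnf⁻ M true  (A ⇒' B) (inj₁ s) a = ⊥-elim (Sat-nnf⁻ M false A s a)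
Sat-nnf⁻ M true  (A ⇒' B) (inj₂ s) a = Sat-nnf⁻ M true B s
Sat-nnf⁻ M false (A ⇒' B) (s , s′) i = Sat-nnf⁻ M false B s′ (i (Sat-nnf⁻ M true A s))
Sat-nnf⁻ M true  (∀' x A) s d = Sat-nnf⁻ M true A (s d)
Sat-nnf⁻ M false (∀' x A) (d , s) a = Sat-nnf⁻ M false A s (a d)
Sat-nnf⁻ M true  (∃' x A) (d , s) = d , Sat-nnf⁻ M true A s
Sat-nnf⁻ M false (∃' x A) s (d , a) = Sat-nnf⁻ M false A (s d) a

-- Symbols, predicates and counters of the clausal form

cross⁺ : ∀ {cs ds C D} → C ∈ cs → D ∈ ds → C ++ D ∈ cross cs ds
cross⁺ {C = C} C∈ D∈ = ∈-concatMap⁺ _ (lose C∈ (∈-map⁺ (C ++_) D∈))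

cross⁻ : ∀ cs ds {E} → E ∈ cross cs ds →
  Σ CClause λ C → Σ CClause λ D → C ∈ cs × D ∈ ds × E ≡ C ++ D
cross⁻ cs ds E∈ with C , C∈ , m ← find (∈-concatMap⁻ _ {xs = cs} E∈)
  with D , D∈ , eq ← ∈-map⁻ (C ++_) m = C , D , C∈ , D∈ , eq

upd-elim : ∀ {e x t y} (Q : CTerm → Set) → (y ≡ x → Q t) → (y ≢ x → Q (e y)) → Q (upd e x t y)
upd-elim {e} {x} {t} {y} Q q₁ q₂ with y ≡ᵇ x in eq
... | true  = q₁ (≡ᵇ⇒≡ y x (subst T (sym eq) tt))
... | false = q₂ (λ y≡x → subst T eq (≡⇒≡ᵇ y x y≡x))

clauses : (Var → CTerm) → List ℕ → ℕ → Formula → List CClause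
clauses e us c A = proj₁ (cl e us c true A)

counter : (Var → CTerm) → List ℕ → ℕ → Formula → ℕ
counter e us c A = proj₂ (cl e us c true A)

counter-≤ : ∀ {A} → NNF A → ∀ e us c → c ≤ counter e us c A
counter-≤ posA e us c = ≤-refl
counter-≤ negA e us c = ≤-refl
counter-≤ top e us c = ≤-refl
counter-≤ bot e us c = ≤-refl
counter-≤ (and a b) e us c = ≤-trans (counter-≤ a e us c) (counter-≤ b e us _)
counter-≤ (or a b) e us c = ≤-trans (counter-≤ a e us c) (counter-≤ b e us _)
counter-≤ (all a) e us c = <⇒≤ (counter-≤ a _ _ (suc c))
counter-≤ (ex a) e us c = <⇒≤ (counter-≤ a _ _ (suc c))

mutual
  symsT-tr : ∀ (R : Sym → Set) e t → (∀ f → FunT f t → R (fn (orig f))) →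
    (∀ x → FreeT x t → ∀ r → r ∈ symsT (e x) → R r) → ∀ r → r ∈ symsT (trT e t) → R r
  symsT-tr R e (var x) Rf Re r r∈ = Re x here r r∈
  symsT-tr R e (fun f ts) Rf Re r (here refl) = Rf f here
  symsT-tr R e (fun f ts) Rf Re r (there r∈) =
    symsTs-tr R e ts (λ g i → Rf g (arg i)) (λ x i → Re x (arg i)) r r∈

  symsTs-tr : ∀ (R : Sym → Set) e ts → (∀ f → Any (FunT f) ts → R (fn (orig f))) →
    (∀ x → Any (FreeT x) ts → ∀ r → r ∈ symsT (e x) → R r) → ∀ r → r ∈ symsTs (trTs e ts) → R r
  symsTs-tr R e (t ∷ ts) Rf Re r r∈ with ∈-++⁻ (symsT (trT e t)) r∈
  ... | inj₁ m = symsT-tr R e t (λ g i → Rf g (here i)) (λ x i → Re x (here i)) r m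
  ... | inj₂ m = symsTs-tr R e ts (λ g i → Rf g (there i)) (λ x i → Re x (there i)) r m

AllSyms : (Sym → Set) → List CClause → Set
AllSyms R S = ∀ {C L r} → C ∈ S → L ∈ C → r ∈ symsL L → R r

AllSyms-++ : ∀ {R} S S′ → AllSyms R S → AllSyms R S′ → AllSyms R (S ++ S′)
AllSyms-++ S S′ h h′ C∈ with ∈-++⁻ S C∈
... | inj₁ m = h m
... | inj₂ m = h′ m

AllSyms-cross : ∀ {R} S S′ → AllSyms R S → AllSyms R S′ → AllSyms R (cross S S′)
AllSyms-cross S S′ h h′ C∈ L∈ r∈ with C , D , C∈S , D∈S′ , refl ← cross⁻ S S′ C∈ with ∈-++⁻ C L∈
... | inj₁ m = h C∈S m r∈
... | inj₂ m = h′ D∈S′ m r∈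

-- The four sources of a symbol in the clausal form of A. The variables in scope are among them
-- because Skolem terms take them as arguments.
record Admits (R : Sym → Set) (e : Var → CTerm) (us : List ℕ) (c : ℕ) (A : Formula) : Set where
  field
    ofFun   : ∀ f → FunIn f A → R (fn (orig f))
    ofFresh : ∀ n → c ≤ n → n < counter e us c A → R (cv n) × R (fn (sk n))
    ofEnv   : ∀ x → FreeIn x A → ∀ r → r ∈ symsT (e x) → R r
    ofScope : ∀ n → n ∈ us → R (cv n)

open Admits

-- R stays abstract so that one induction serves two purposes: `Below` for freshness and `Origin`
-- for the vocabulary.
clauses-syms : ∀ {R A} → NNF A → ∀ e us c → Admits R e us c A → AllSyms R (clauses e us c A)
clauses-syms {R} (posA {ts = ts}) e us c h (here refl) (here refl) =
  symsTs-tr R e ts (λ f → ofFun h f ∘ atm) (λ x → ofEnv h x ∘ atm) _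
clauses-syms {R} (negA {ts = ts}) e us c h (here refl) (here refl) =
  symsTs-tr R e ts (λ f i → ofFun h f (neg (atm i))) (λ x i → ofEnv h x (neg (atm i))) _
clauses-syms bot e us c h (here refl) ()
clauses-syms (and {A} {B} a b) e us c h = AllSyms-++ _ (clauses e us (counter e us c A) B)
  (clauses-syms a e us c record
    { ofFun = λ f → ofFun h f ∘ andl
    ; ofFresh = λ n l u → ofFresh h n l (<-≤-trans u (counter-≤ b e us _))
    ; ofEnv = λ x → ofEnv h x ∘ andl ; ofScope = ofScope h })
  (clauses-syms b e us _ record
    { ofFun = λ f → ofFun h f ∘ andr
    ; ofFresh = λ n l u → ofFresh h n (≤-trans (counter-≤ a e us c) l) u
    ; ofEnv = λ x → ofEnv h x ∘ andr ; ofScope = ofScope h })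
clauses-syms (or {A} {B} a b) e us c h = AllSyms-cross _ (clauses e us (counter e us c A) B)
  (clauses-syms a e us c record
    { ofFun = λ f → ofFun h f ∘ orl
    ; ofFresh = λ n l u → ofFresh h n l (<-≤-trans u (counter-≤ b e us _))
    ; ofEnv = λ x → ofEnv h x ∘ orl ; ofScope = ofScope h })
  (clauses-syms b e us _ record
    { ofFun = λ f → ofFun h f ∘ orr
    ; ofFresh = λ n l u → ofFresh h n (≤-trans (counter-≤ a e us c) l) u
    ; ofEnv = λ x → ofEnv h x ∘ orr ; ofScope = ofScope h })
clauses-syms {R} (all {x} {A} a) e us c h = clauses-syms a _ _ (suc c) record
  { ofFun = λ f → ofFun h f ∘ all
  ; ofFresh = λ n l u → ofFresh h n (<⇒≤ l) u
  ; ofEnv = λ y i → upd-elim {e} {x} {cvar c} (λ t → ∀ r → r ∈ symsT t → R r)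
      (λ { _ r (here refl) → fresh }) (λ y≢x → ofEnv h y (all y≢x i))
  ; ofScope = λ { n (here refl) → fresh ; n (there n∈) → ofScope h n n∈ } }
  where fresh = proj₁ (ofFresh h c ≤-refl (counter-≤ a _ _ (suc c)))
clauses-syms {R} (ex {x} {A} a) e us c h = clauses-syms a _ _ (suc c) record
  { ofFun = λ f → ofFun h f ∘ ex
  ; ofFresh = λ n l u → ofFresh h n (<⇒≤ l) u
  ; ofEnv = λ y i → upd-elim {e} {x} {cfun (sk c) (map cvar us)} (λ t → ∀ r → r ∈ symsT t → R r)
      (λ _ → skolem) (λ y≢x → ofEnv h y (ex y≢x i))
  ; ofScope = ofScope h }
  where
  skolem : ∀ r → r ∈ symsT (cfun (sk c) (map cvar us)) → R r
  skolem r (here refl) = proj₂ (ofFresh h c ≤-refl (counter-≤ a _ _ (suc c)))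
  skolem r (there r∈) with n , n∈ , refl ← symsTs-map-cvar us r∈ = ofScope h n n∈

signPol : Bool → Polarity
signPol true  = pos
signPol false = neg

clauses-preds : ∀ {A} → NNF A → ∀ e us c {C s p ts} → C ∈ clauses e us c A → lit s p ts ∈ C →
  PredIn p (signPol s) A
clauses-preds posA e us c (here refl) (here refl) = atm
clauses-preds negA e us c (here refl) (here refl) = neg atm
clauses-preds bot e us c (here refl) ()
clauses-preds (and {A} a b) e us c C∈ L∈ with ∈-++⁻ (clauses e us c A) C∈
... | inj₁ m = andl (clauses-preds a e us c m L∈)
... | inj₂ m = andr (clauses-preds b e us _ m L∈)
clauses-preds (or {A} {B} a b) e us c C∈ L∈
  with C , D , C∈A , D∈B , refl ← cross⁻ (clauses e us c A) (clauses e us (counter e us c A) B) C∈ with ∈-++⁻ C L∈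
... | inj₁ m = orl (clauses-preds a e us c C∈A m)
... | inj₂ m = orr (clauses-preds b e us _ D∈B m)
clauses-preds (all a) e us c C∈ L∈ = all (clauses-preds a _ _ _ C∈ L∈)
clauses-preds (ex a) e us c C∈ L∈ = ex (clauses-preds a _ _ _ C∈ L∈)

-- Evaluation of clause terms

-- It has the same body as `update`, so its lemmas apply to `update` by computation.
override : {X : Set} → (ℕ → X) → ℕ → X → ℕ → X
override g x d y = if y ≡ᵇ x then d else g y

override-same : ∀ {X : Set} (g : ℕ → X) x d → override g x d x ≡ d
override-same g x d with x ≡ᵇ x in eq
... | true  = refl
... | false = ⊥-elim (subst T eq (≡⇒≡ᵇ x x refl))

override-other : ∀ {X : Set} (g : ℕ → X) {x y} d → y ≢ x → override g x d y ≡ g y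
override-other g {x} {y} d y≢x with y ≡ᵇ x in eq
... | true  = ⊥-elim (y≢x (≡ᵇ⇒≡ y x (subst T (sym eq) tt)))
... | false = refl

override-cong : ∀ {X : Set} {g h : ℕ → X} x d → (∀ y → g y ≡ h y) → ∀ y → override g x d y ≡ override h x d y
override-cong x d eq y with y ≡ᵇ x
... | true  = refl
... | false = eq y

record Interp (D : Set) : Set where
  field
    cvI : ℕ → D
    paI : Var → D
    fnI : CFun → List D → D

open Interp

mutual
  evalI : ∀ {D} → Interp D → CTerm → D
  evalI I (cvar n)    = cvI I n
  evalI I (param x)   = paI I x
  evalI I (cfun f ts) = fnI I f (evalIs I ts)

  evalIs : ∀ {D} → Interp D → List CTerm → List D
  evalIs I []       = []
  evalIs I (t ∷ ts) = evalI I t ∷ evalIs I ts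

Agree : ∀ {D} → Interp D → Interp D → Sym → Set
Agree I J (cv n) = cvI I n ≡ cvI J n
Agree I J (pa x) = paI I x ≡ paI J x
Agree I J (fn f) = ∀ ds → fnI I f ds ≡ fnI J f ds

mutual
  evalI-cong : ∀ {D} {I J : Interp D} t → (∀ r → r ∈ symsT t → Agree I J r) → evalI I t ≡ evalI J t
  evalI-cong (cvar n) h = h _ (here refl)
  evalI-cong (param x) h = h _ (here refl)
  evalI-cong {I = I} (cfun f ts) h =
    trans (cong (fnI I f) (evalIs-cong ts (λ r → h r ∘ there))) (h _ (here refl) _)

  evalIs-cong : ∀ {D} {I J : Interp D} ts → (∀ r → r ∈ symsTs ts → Agree I J r) → evalIs I ts ≡ evalIs J ts
  evalIs-cong [] h = refl
  evalIs-cong (t ∷ ts) h =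
    cong₂ _∷_ (evalI-cong t (λ r → h r ∘ ∈-++⁺ˡ)) (evalIs-cong ts (λ r → h r ∘ ∈-++⁺ʳ (symsT t)))

evalIs-cvar : ∀ {D} (I : Interp D) us → evalIs I (map cvar us) ≡ map (cvI I) us
evalIs-cvar I []       = refl
evalIs-cvar I (u ∷ us) = cong (_ ∷_) (evalIs-cvar I us)

map-≡-∈ : ∀ {X : Set} {g h : ℕ → X} us → map g us ≡ map h us → ∀ n → n ∈ us → g n ≡ h n
map-≡-∈ (u ∷ us) eq n (here refl) = ∷-injectiveˡ eq
map-≡-∈ (u ∷ us) eq n (there n∈) = map-≡-∈ us (∷-injectiveʳ eq) n n∈

Holds : (Atom → Set) → Literal → Set
Holds v (lit true  p ts) = v (p , ts)
Holds v (lit false p ts) = ¬ v (p , ts)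

Holds-map : ∀ {v w : Atom → Set} L → (v (atomOf L) → w (atomOf L)) → (w (atomOf L) → v (atomOf L)) →
  Holds v L → Holds w L
Holds-map (lit true  p ts) to from h = to h
Holds-map (lit false p ts) to from h = h ∘ from

-- Under this invariant the number c is fresh: reinterpreting clause variables or Skolem symbols
-- from c onwards leaves the values of the terms in e unchanged.
record WellScoped (e : Var → CTerm) (us : List ℕ) (c : ℕ) : Set where
  field
    scope<  : ∀ n → n ∈ us → n < c
    envVars : ∀ x n → cv n ∈ symsT (e x) → n ∈ us
    envSk   : ∀ x n → fn (sk n) ∈ symsT (e x) → n < c

open WellScoped

WellScoped-mono : ∀ {e us c c′} → c ≤ c′ → WellScoped e us c → WellScoped e us c′
WellScoped-mono c≤c′ w = record
  { scope< = λ n n∈ → <-≤-trans (scope< w n n∈) c≤c′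
  ; envVars = envVars w
  ; envSk = λ x n m → <-≤-trans (envSk w x n m) c≤c′ }

WellScoped-param : ∀ c → WellScoped param [] c
WellScoped-param c = record
  { scope< = λ _ () ; envVars = λ { _ _ (here ()) } ; envSk = λ { _ _ (here ()) } }

WellScoped-cvar : ∀ {e us c} x → WellScoped e us c → WellScoped (upd e x (cvar c)) (c ∷ us) (suc c)
WellScoped-cvar {e} {us} {c} x w = record
  { scope< = λ { n (here refl) → ≤-refl ; n (there n∈) → m<n⇒m<1+n (scope< w n n∈) }
  ; envVars = λ y → upd-elim {e} {x} {cvar c} (λ t → ∀ n → cv n ∈ symsT t → n ∈ c ∷ us)
      (λ { _ _ (here refl) → here refl }) (λ _ n m → there (envVars w y n m))
  ; envSk = λ y → upd-elim {e} {x} {cvar c} (λ t → ∀ n → fn (sk n) ∈ symsT t → n < suc c)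
      (λ { _ _ (here ()) }) (λ _ n m → m<n⇒m<1+n (envSk w y n m)) }

WellScoped-skolem : ∀ {e us c} x → WellScoped e us c →
  WellScoped (upd e x (cfun (sk c) (map cvar us))) us (suc c)
WellScoped-skolem {e} {us} {c} x w = record
  { scope< = λ n n∈ → m<n⇒m<1+n (scope< w n n∈)
  ; envVars = λ y → upd-elim {e} {x} {t₀} (λ t → ∀ n → cv n ∈ symsT t → n ∈ us)
      (λ _ → vars₀) (λ _ → envVars w y)
  ; envSk = λ y → upd-elim {e} {x} {t₀} (λ t → ∀ n → fn (sk n) ∈ symsT t → n < suc c)
      (λ _ → sk₀) (λ _ n m → m<n⇒m<1+n (envSk w y n m)) }
  where
  t₀ = cfun (sk c) (map cvar us)
  vars₀ : ∀ n → cv n ∈ symsT t₀ → n ∈ us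
  vars₀ n (there m) with _ , n∈ , refl ← symsTs-map-cvar us m = n∈
  sk₀ : ∀ n → fn (sk n) ∈ symsT t₀ → n < suc c
  sk₀ n (here refl) = ≤-refl
  sk₀ n (there m) with _ , _ , () ← symsTs-map-cvar us m

Below : ℕ → Sym → Set
Below c (cv n)        = n < c
Below c (pa x)        = ⊤
Below c (fn (orig f)) = ⊤
Below c (fn (sk n))   = n < c

clauses-below : ∀ {A} → NNF A → ∀ {e us c} → WellScoped e us c → AllSyms (Below (counter e us c A)) (clauses e us c A)
clauses-below {A} a {e} {us} {c} w = clauses-syms a e us c record
  { ofFun = λ _ _ → tt
  ; ofFresh = λ _ _ u → u , u
  ; ofEnv = λ x _ → env x
  ; ofScope = λ n n∈ → <-≤-trans (scope< w n n∈) (counter-≤ a e us c) }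
  where
  env : ∀ x r → r ∈ symsT (e x) → Below (counter e us c A) r
  env x (cv n) m = <-≤-trans (scope< w n (envVars w x n m)) (counter-≤ a e us c)
  env x (pa y) m = tt
  env x (fn (orig f)) m = tt
  env x (fn (sk n)) m = <-≤-trans (envSk w x n m) (counter-≤ a e us c)

-- Semantics of clausal forms: Skolemization and its converse.

module Semantics (M : Structure) where
  open Structure M

  -- Assignments built in different ways agree only pointwise; this transports satisfaction between
  -- them without function extensionality.
  Sat-ext : ∀ A {ρ ρ′ : Var → D} → (∀ x → ρ x ≡ ρ′ x) → Sat M ρ A → Sat M ρ′ A
  evalT-ext : ∀ t {ρ ρ′ : Var → D} → (∀ x → ρ x ≡ ρ′ x) → evalT M ρ t ≡ evalT M ρ′ t
  evalTs-ext : ∀ ts {ρ ρ′ : Var → D} → (∀ x → ρ x ≡ ρ′ x) → evalTs M ρ ts ≡ evalTs M ρ′ ts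
  evalT-ext (var x) h = h x
  evalT-ext (fun f ts) h = cong (funI f) (evalTs-ext ts h)
  evalTs-ext [] h = refl
  evalTs-ext (t ∷ ts) h = cong₂ _∷_ (evalT-ext t h) (evalTs-ext ts h)
  Sat-ext (atom p ts) h s = subst (predI p) (evalTs-ext ts h) s
  Sat-ext ⊤' h s = s
  Sat-ext (¬' A) h s a = s (Sat-ext A (sym ∘ h) a)
  Sat-ext (A ∧' B) h (s , s′) = Sat-ext A h s , Sat-ext B h s′
  Sat-ext (A ∨' B) h (inj₁ s) = inj₁ (Sat-ext A h s)
  Sat-ext (A ∨' B) h (inj₂ s) = inj₂ (Sat-ext B h s)
  Sat-ext (A ⇒' B) h s a = Sat-ext B h (s (Sat-ext A (sym ∘ h) a))
  Sat-ext (∀' x A) h s d = Sat-ext A (override-cong x d h) (s d)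
  Sat-ext (∃' x A) h (d , s) = d , Sat-ext A (override-cong x d h) s

  SkInterp : Set
  SkInterp = ℕ → List D → D

  funInterp : SkInterp → CFun → List D → D
  funInterp skI (orig f) = funI f
  funInterp skI (sk n)   = skI n

  interp : (Var → D) → SkInterp → (ℕ → D) → Interp D
  interp ρ skI η = record { cvI = η ; paI = ρ ; fnI = funInterp skI }

  valuation : Interp D → Atom → Set
  valuation I (p , ts) = predI p (evalIs I ts)

  Holds-cong : ∀ {I J} L → (∀ r → r ∈ symsL L → Agree I J r) → Holds (valuation I) L → Holds (valuation J) L
  Holds-cong (lit s p ts) h =
    Holds-map (lit s p ts) (subst (predI p) (evalIs-cong ts h)) (subst (predI p) (sym (evalIs-cong ts h)))

  module _ (ρ : Var → D) where

    env : SkInterp → (ℕ → D) → (Var → CTerm) → Var → D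
    env skI η e x = evalI (interp ρ skI η) (e x)

    evalI-tr : ∀ skI η e t → evalI (interp ρ skI η) (trT e t) ≡ evalT M (env skI η e) t
    evalIs-tr : ∀ skI η e ts → evalIs (interp ρ skI η) (trTs e ts) ≡ evalTs M (env skI η e) ts
    evalI-tr skI η e (var x) = refl
    evalI-tr skI η e (fun f ts) = cong (funI f) (evalIs-tr skI η e ts)
    evalIs-tr skI η e [] = refl
    evalIs-tr skI η e (t ∷ ts) = cong₂ _∷_ (evalI-tr skI η e t) (evalIs-tr skI η e ts)

    env-upd : ∀ skI η e x t y →
      env skI η (upd e x t) y ≡ update M (env skI η e) x (evalI (interp ρ skI η) t) y
    env-upd skI η e x t y with y ≡ᵇ x
    ... | true  = refl
    ... | false = refl

    env-cong : ∀ {e us c} → WellScoped e us c → ∀ {skI skI′ η η′} →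
      (∀ n → n < c → ∀ ds → skI n ds ≡ skI′ n ds) → (∀ n → n ∈ us → η n ≡ η′ n) →
      ∀ x → env skI η e x ≡ env skI′ η′ e x
    env-cong {e} w {skI} {skI′} {η} {η′} hs hη x = evalI-cong (e x) agree
      where
      agree : ∀ r → r ∈ symsT (e x) → Agree (interp ρ skI η) (interp ρ skI′ η′) r
      agree (cv n) m = hη n (envVars w x n m)
      agree (pa y) m = refl
      agree (fn (orig f)) m ds = refl
      agree (fn (sk n)) m ds = hs n (envSk w x n m) ds

    Any-Holds-cong : ∀ {A} → NNF A → ∀ {e us c} → WellScoped e us c → ∀ {skI skI′ η η′} →
      (∀ n → n < counter e us c A → ∀ ds → skI n ds ≡ skI′ n ds) →
      (∀ n → n < counter e us c A → η n ≡ η′ n) →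
      ∀ {C} → C ∈ clauses e us c A →
      Any (Holds (valuation (interp ρ skI η))) C → Any (Holds (valuation (interp ρ skI′ η′))) C
    Any-Holds-cong {A} a {e} {us} {c} w {skI} {skI′} {η} {η′} hs hη C∈ h with L , L∈ , hL ← find h =
      lose L∈ (Holds-cong L (λ r r∈ → agree r (clauses-below a w C∈ L∈ r∈)) hL)
      where
      agree : ∀ r → Below (counter e us c A) r → Agree (interp ρ skI η) (interp ρ skI′ η′) r
      agree (cv n) b = hη n b
      agree (pa y) b = refl
      agree (fn (orig f)) b ds = refl
      agree (fn (sk n)) b ds = hs n b ds

    AllHold : SkInterp → (ℕ → D) → List CClause → Set
    AllHold skI η S = ∀ C → C ∈ S → Any (Holds (valuation (interp ρ skI η))) C

    module _ (em : ExcludedMiddle 0ℓ) where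

      -- The guard P makes the statement compositional at a disjunction:
      -- the clauses of a disjunct need to hold only at those η at which that disjunct is satisfied.
      skolemize : ∀ {A} → NNF A → ∀ e us c → WellScoped e us c → (skI : SkInterp) (P : (ℕ → D) → Set) →
        (∀ η → P η → Sat M (env skI η e) A) →
        Σ SkInterp λ skI′ → (∀ n → n < c → ∀ ds → skI n ds ≡ skI′ n ds) ×
          (∀ η → P η → AllHold skI′ η (clauses e us c A))
      skolemize (posA {p} {ts}) e us c w skI P h = skI , (λ _ _ _ → refl) , λ
        { η Pη C (here refl) → here (subst (predI p) (sym (evalIs-tr skI η e ts)) (h η Pη)) }
      skolemize (negA {p} {ts}) e us c w skI P h = skI , (λ _ _ _ → refl) , λ
        { η Pη C (here refl) → here (h η Pη ∘ subst (predI p) (evalIs-tr skI η e ts)) }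
      skolemize top e us c w skI P h = skI , (λ _ _ _ → refl) , λ _ _ _ ()
      skolemize bot e us c w skI P h = skI , (λ _ _ _ → refl) , λ η Pη → ⊥-elim (h η Pη)
      skolemize (and {A} {B} a b) e us c w skI P h
        with skI₁ , agr₁ , hold₁ ← skolemize a e us c w skI P (λ η → proj₁ ∘ h η)
        with skI₂ , agr₂ , hold₂ ← skolemize b e us (counter e us c A) (WellScoped-mono (counter-≤ a e us c) w) skI₁ P
               (λ η Pη → Sat-ext B (env-cong w agr₁ (λ _ _ → refl)) (proj₂ (h η Pη)))
        = skI₂ , (λ n n<c ds → trans (agr₁ n n<c ds) (agr₂ n (<-≤-trans n<c (counter-≤ a e us c)) ds)) , hold
        where
        hold : ∀ η → P η → AllHold skI₂ η (clauses e us c A ++ clauses e us (counter e us c A) B)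
        hold η Pη C C∈ with ∈-++⁻ (clauses e us c A) C∈
        ... | inj₁ m = Any-Holds-cong a w agr₂ (λ _ _ → refl) m (hold₁ η Pη C m)
        ... | inj₂ m = hold₂ η Pη C m
      skolemize (or {A} {B} a b) e us c w skI P h
        with skI₁ , agr₁ , hold₁ ← skolemize a e us c w skI (λ η → Sat M (env skI η e) A) (λ η → id)
        with skI₂ , agr₂ , hold₂ ← skolemize b e us (counter e us c A) (WellScoped-mono (counter-≤ a e us c) w) skI₁
               (λ η → Sat M (env skI η e) B)
               (λ η → Sat-ext B (env-cong w agr₁ (λ _ _ → refl)))
        = skI₂ , (λ n n<c ds → trans (agr₁ n n<c ds) (agr₂ n (<-≤-trans n<c (counter-≤ a e us c)) ds)) , hold
        where
        hold : ∀ η → P η → AllHold skI₂ η (cross (clauses e us c A) (clauses e us (counter e us c A) B))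
        hold η Pη E E∈
          with C , D′ , C∈ , D∈ , refl ← cross⁻ (clauses e us c A) (clauses e us (counter e us c A) B) E∈
          with h η Pη
        ... | inj₁ s = Anyₚ.++⁺ˡ (Any-Holds-cong a w agr₂ (λ _ _ → refl) C∈ (hold₁ η s C C∈))
        ... | inj₂ s = Anyₚ.++⁺ʳ C (hold₂ η s D′ D∈)
      skolemize (all {x} {A} a) e us c w skI P h
        with skI₁ , agr₁ , hold₁ ← skolemize a _ _ (suc c) (WellScoped-cvar x w) skI P
               (λ η Pη → Sat-ext A (λ y → sym (env-upd skI η e x (cvar c) y)) (h η Pη (η c)))
        = skI₁ , (λ n n<c → agr₁ n (m<n⇒m<1+n n<c)) , hold₁
      skolemize (ex {x} {A} a) e us c w skI P h =
        let skI₂ , agr₂ , hold₂ = skolemize a _ us (suc c) (WellScoped-skolem x w) skI₁ P sat₁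
        in skI₂ , (λ n n<c ds → trans (agr₁ n n<c ds) (agr₂ n (m<n⇒m<1+n n<c) ds)) , hold₂
        where
        -- A Skolem function sees only the values of the variables in scope. The witness may
        -- therefore come from a different η with the same values there, and `env-cong` carries it
        -- over.
        Witness : List D → Set
        Witness ds = Σ (ℕ → D) λ η → Σ D λ d → map η us ≡ ds × Sat M (update M (env skI η e) x d) A
        pick : ∀ {ds} → Dec (Witness ds) → D
        pick (yes (η , d , _)) = d
        -- An arbitrary default: under P the argument list does have a witness, as `pick-sat` shows.
        pick (no _) = elem
        pick-sat : ∀ η → P η → (w? : Dec (Witness (map η us))) → Sat M (update M (env skI η e) x (pick w?)) A
        pick-sat η Pη (yes (η′ , d , eq , s)) =
          Sat-ext A (override-cong x d (env-cong w (λ _ _ _ → refl) (map-≡-∈ us eq))) s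
        pick-sat η Pη (no ¬w) with d , s ← h η Pη = ⊥-elim (¬w (η , d , refl , s))
        skI₁ : SkInterp
        skI₁ = override skI c (λ ds → pick (em {P = Witness ds}))
        agr₁ : ∀ n → n < c → ∀ ds → skI n ds ≡ skI₁ n ds
        agr₁ n n<c ds = cong (λ g → g ds) (sym (override-other skI _ (<⇒≢ n<c)))
        sat₁ : ∀ η → P η → Sat M (env skI₁ η (upd e x (cfun (sk c) (map cvar us)))) A
        sat₁ η Pη = Sat-ext A eq (pick-sat η Pη em)
          where
          d₀ = pick (em {P = Witness (map η us)})
          d₀≡ : d₀ ≡ evalI (interp ρ skI₁ η) (cfun (sk c) (map cvar us))
          d₀≡ = trans (cong (λ g → g (map η us)) (sym (override-same skI c _)))
                  (cong (skI₁ c) (sym (evalIs-cvar (interp ρ skI₁ η) us)))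
          eq : ∀ y → update M (env skI η e) x d₀ y ≡ env skI₁ η (upd e x (cfun (sk c) (map cvar us))) y
          eq y = trans (override-cong x d₀ (env-cong w agr₁ (λ _ _ → refl)) y)
                   (trans (cong (λ d → update M (env skI₁ η e) x d y) d₀≡)
                     (sym (env-upd skI₁ η e x _ y)))

      -- At a disjunction, a failing instance of a clause of A has its variables
      -- below the counter from which those of B start, so it can be fixed while B varies.
      unskolemize : ∀ {A} → NNF A → ∀ e us c → WellScoped e us c → ∀ skI η₀ →
        (∀ η → (∀ n → n < c → η n ≡ η₀ n) → AllHold skI η (clauses e us c A)) →
        Sat M (env skI η₀ e) A
      unskolemize (posA {p} {ts}) e us c w skI η₀ h with h η₀ (λ _ _ → refl) _ (here refl)
      ... | here s = subst (predI p) (evalIs-tr skI η₀ e ts) s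
      unskolemize (negA {p} {ts}) e us c w skI η₀ h with h η₀ (λ _ _ → refl) _ (here refl)
      ... | here s = s ∘ subst (predI p) (sym (evalIs-tr skI η₀ e ts))
      unskolemize top e us c w skI η₀ h = tt
      unskolemize bot e us c w skI η₀ h with () ← h η₀ (λ _ _ → refl) _ (here refl)
      unskolemize (and {A} a b) e us c w skI η₀ h =
        unskolemize a e us c w skI η₀ (λ η eq C → h η eq C ∘ ∈-++⁺ˡ) ,
        unskolemize b e us _ (WellScoped-mono (counter-≤ a e us c) w) skI η₀
          (λ η eq C → h η (λ n n<c → eq n (<-≤-trans n<c (counter-≤ a e us c))) C ∘ ∈-++⁺ʳ (clauses e us c A))
      unskolemize (or {A} {B} a b) e us c w skI η₀ h
        with em {P = Σ (ℕ → D) λ η → (∀ n → n < c → η n ≡ η₀ n) × Σ CClause λ C →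
                     C ∈ clauses e us c A × ¬ Any (Holds (valuation (interp ρ skI η))) C}
      ... | no ¬f = inj₁ (unskolemize a e us c w skI η₀
                     (λ η eq C C∈ → decidable-stable em (λ ¬h → ¬f (η , eq , C , C∈ , ¬h))))
      ... | yes (η₁ , eq₁ , C , C∈ , ¬hC) = inj₂
          (Sat-ext B (env-cong w (λ _ _ _ → refl) (λ n n∈ → eq₁ n (scope< w n n∈)))
            (unskolemize b e us _ (WellScoped-mono (counter-≤ a e us c) w) skI η₁ holdB))
        where
        holdB : ∀ η → (∀ n → n < counter e us c A → η n ≡ η₁ n) → AllHold skI η (clauses e us (counter e us c A) B)
        holdB η eq D′ D∈
          with Anyₚ.++⁻ C (h η (λ n n<c → trans (eq n (<-≤-trans n<c (counter-≤ a e us c))) (eq₁ n n<c)) _ (cross⁺ C∈ D∈))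
        ... | inj₁ hC = ⊥-elim (¬hC (Any-Holds-cong a w (λ _ _ _ → refl) eq C∈ hC))
        ... | inj₂ hD = hD
      unskolemize (all {x} {A} a) e us c w skI η₀ h d =
        Sat-ext A eq (unskolemize a _ _ (suc c) (WellScoped-cvar x w) skI η₁
          (λ η agr → h η (λ n n<c → trans (agr n (m<n⇒m<1+n n<c)) (override-other η₀ d (<⇒≢ n<c)))))
        where
        η₁ = override η₀ c d
        eq : ∀ y → env skI η₁ (upd e x (cvar c)) y ≡ update M (env skI η₀ e) x d y
        eq y = trans (env-upd skI η₁ e x (cvar c) y)
                 (trans (cong (λ d′ → update M (env skI η₁ e) x d′ y) (override-same η₀ c d))
                   (override-cong x d (env-cong w (λ _ _ _ → refl)
                     (λ n n∈ → override-other η₀ d (<⇒≢ (scope< w n n∈)))) y))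
      unskolemize (ex {x} {A} a) e us c w skI η₀ h =
        -- The witness is the value of the Skolem term at η₀.
        _ , Sat-ext A (env-upd skI η₀ e x _)
              (unskolemize a _ us (suc c) (WellScoped-skolem x w) skI η₀
                (λ η agr → h η (λ n n<c → agr n (m<n⇒m<1+n n<c))))

-- Completeness of clausal tableaux

module Saturation (em : ExcludedMiddle 0ℓ) (S : List CClause) (¬closed : ¬ ClosedTableau S) where

  OpenBranch : Set
  OpenBranch = Σ (List Literal) λ br → ¬ Tableau S br

  -- Stage n of the branch treats the clause instance with code n. Since every instance has a code,
  -- each gets its turn.
  InstanceCoded : ℕ → Set
  InstanceCoded n = Σ CClause λ C → C ∈ S × Σ (ℕ → CTerm) λ σ → codeClause (map (instLit σ) C) ≡ n

  -- If all children could be closed, `extend` would close the node itself.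
  openChild : ∀ {br} → ¬ Tableau S br → ∀ C → C ∈ S → ∀ σ →
    Any (λ L → ¬ Tableau S (L ∷ br)) (map (instLit σ) C)
  openChild ¬t C C∈ σ = Allₚ.¬All⇒Any¬ (λ _ → em) (map (instLit σ) C) (¬t ∘ extend C C∈ σ)

  step : ∀ {n} → Dec (InstanceCoded n) → OpenBranch → OpenBranch
  step (yes (C , C∈ , σ , _)) (br , ¬t) =
    let L , _ , ¬tL = find (openChild ¬t C C∈ σ) in L ∷ br , ¬tL
  step (no _) b = b

  step-⊆ : ∀ {n} (d : Dec (InstanceCoded n)) b {L} → L ∈ proj₁ b → L ∈ proj₁ (step d b)
  step-⊆ (yes _) b L∈ = there L∈
  step-⊆ (no _)  b L∈ = L∈

  step-hits : ∀ C → C ∈ S → ∀ σ (d : Dec (InstanceCoded (codeClause (map (instLit σ) C)))) b →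
    Any (_∈ proj₁ (step d b)) (map (instLit σ) C)
  step-hits C C∈ σ (yes (C′ , C′∈ , σ′ , eq)) (br , ¬t) =
    let L , L∈ , _ = find (openChild ¬t C′ C′∈ σ′)
    -- The stage may have chosen another clause and substitution with this code; by injectivity they
    -- yield the same instance.
    in lose (subst (L ∈_) (codeClause-injective _ _ eq) L∈) (here refl)
  step-hits C C∈ σ (no ¬i) b = ⊥-elim (¬i (C , C∈ , σ , refl))

  branch : ℕ → OpenBranch
  branch zero    = [] , ¬closed
  branch (suc n) = step (em {P = InstanceCoded n}) (branch n)

  branch-mono : ∀ {m n L} → m ≤′ n → L ∈ proj₁ (branch m) → L ∈ proj₁ (branch n)
  branch-mono ≤′-refl L∈ = L∈
  branch-mono (≤′-step {n = n} m≤n) L∈ = step-⊆ (em {P = InstanceCoded n}) (branch n) (branch-mono m≤n L∈)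

  OnBranch : Literal → Set
  OnBranch L = Σ ℕ λ n → L ∈ proj₁ (branch n)

  -- Both literals are present at stage `m ⊔ n`, where the branch would then close.
  OnBranch-consistent : ∀ p ts → OnBranch (lit true p ts) → OnBranch (lit false p ts) → ⊥
  OnBranch-consistent p ts (m , L∈) (n , L′∈) = proj₂ (branch (m ⊔ n))
    (close (p , ts , branch-mono (≤⇒≤′ (m≤m⊔n m n)) L∈ , branch-mono (≤⇒≤′ (m≤n⊔m m n)) L′∈))

  OnBranch-saturated : ∀ C → C ∈ S → ∀ σ → Any OnBranch (map (instLit σ) C)
  OnBranch-saturated C C∈ σ =
    Any.map (λ L∈ → suc n , L∈) (step-hits C C∈ σ (em {P = InstanceCoded n}) (branch n))
    where n = codeClause (map (instLit σ) C)

  -- The domain contains all clause terms, including those with clause variables, so that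
  -- substitutions and assignments of clause variables coincide. Skolem symbols are interpreted by
  -- themselves in `herbrandI`.
  herbrand : Structure
  herbrand = record
    { D = CTerm ; elem = param 0 ; funI = λ f → cfun (orig f)
    ; predI = λ p ts → OnBranch (lit true p ts) }

  open Semantics herbrand

  herbrandI : (ℕ → CTerm) → Interp CTerm
  herbrandI = interp param (λ n → cfun (sk n))

  evalI-subst : ∀ η t → evalI (herbrandI η) t ≡ substT η t
  evalIs-subst : ∀ η ts → evalIs (herbrandI η) ts ≡ substTs η ts
  evalI-subst η (cvar n) = refl
  evalI-subst η (param x) = refl
  evalI-subst η (cfun (orig f) ts) = cong (cfun (orig f)) (evalIs-subst η ts)
  evalI-subst η (cfun (sk n) ts) = cong (cfun (sk n)) (evalIs-subst η ts)
  evalIs-subst η [] = refl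
  evalIs-subst η (t ∷ ts) = cong₂ _∷_ (evalI-subst η t) (evalIs-subst η ts)

  OnBranch⇒Holds : ∀ η L → OnBranch (instLit η L) → Holds (valuation (herbrandI η)) L
  OnBranch⇒Holds η (lit true  p ts) b rewrite evalIs-subst η ts = b
  OnBranch⇒Holds η (lit false p ts) b rewrite evalIs-subst η ts = λ b′ → OnBranch-consistent p _ b′ b

  herbrand-AllHold : ∀ η → AllHold param (λ n → cfun (sk n)) η S
  herbrand-AllHold η C C∈ = Any.map (OnBranch⇒Holds η _) (Anyₚ.map⁻ (OnBranch-saturated C C∈ η))

clausalForm-nnf : ∀ F G → clausalForm F G ≡ clauses param [] 0 (nnf true F ∧' nnf false G)
clausalForm-nnf F G = cong proj₁ (cl-nnf true (F ∧' (¬' G)) param [] 0)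

tableau-complete : ExcludedMiddle 0ℓ → ∀ F G → F ⊨ G → TableauProof F G
tableau-complete em F G F⊨G = decidable-stable em λ ¬T →
  let open Saturation em (clausalForm F G) ¬T
      satF , satG = Semantics.unskolemize herbrand param em (and (nnf-NNF true F) (nnf-NNF false G))
                      param [] 0 (WellScoped-param 0) (λ n → cfun (sk n)) cvar
                      (λ η _ C C∈ → herbrand-AllHold η C (subst (C ∈_) (sym (clausalForm-nnf F G)) C∈))
  in Sat-nnf⁻ herbrand false G satG (F⊨G herbrand param (Sat-nnf⁻ herbrand true F satF))

-- Horn interpolation of propositional clauses

Models : (Atom → Set) → List CClause → Set
Models v S = ∀ C → C ∈ S → Any (Holds v) C

-- Positive atoms are compared rather than counted, which is the form that `least-model` uses.
AtMostOnePositive : CClause → Set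
AtMostOnePositive C = ∀ a b → literal true a ∈ C → literal true b ∈ C → a ≡ b

sublists : ∀ {X : Set} → List X → List (List X)
sublists []       = [] ∷ []
sublists (x ∷ xs) = map (x ∷_) (sublists xs) ++ sublists xs

filter∈sublists : ∀ {X : Set} {P : X → Set} (P? : Decidable P) xs → filter P? xs ∈ sublists xs
filter∈sublists P? [] = here refl
filter∈sublists P? (x ∷ xs) with does (P? x)
... | true  = ∈-++⁺ˡ (∈-map⁺ (x ∷_) (filter∈sublists P? xs))
... | false = ∈-++⁺ʳ (map (x ∷_) (sublists xs)) (filter∈sublists P? xs)

sublists-⊆ : ∀ {X : Set} xs {ys : List X} {y} → ys ∈ sublists xs → y ∈ ys → y ∈ xs
sublists-⊆ [] (here refl) ()
sublists-⊆ (x ∷ xs) ys∈ y∈ with ∈-++⁻ (map (x ∷_) (sublists xs)) ys∈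
... | inj₂ m = there (sublists-⊆ xs m y∈)
... | inj₁ m with zs , zs∈ , refl ← ∈-map⁻ (x ∷_) m with y∈
...   | here refl = here refl
...   | there y∈zs = there (sublists-⊆ xs zs∈ y∈zs)

-- a Horn clause, as its list of premises and its optional conclusion
Rule : Set
Rule = List Atom × Maybe Atom

HeadHolds : (Atom → Set) → Maybe Atom → Set
HeadHolds v nothing  = ⊥
HeadHolds v (just a) = v a

RuleHolds : (Atom → Set) → Rule → Set
RuleHolds v (as , h) = All v as → HeadHolds v h

module HornRules (IF IG : List CClause) where

  open DecMembership _≟ᵃ_ using () renaming (_∈?_ to _∈ᵃ?_)
  open DecMembership _≟ˡ_ using () renaming (_∈?_ to _∈ˡ?_)

  atomsF : List Atom
  atomsF = map atomOf (concat IF)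

  -- A valuation of the atoms of `IF` is represented by the list of its true atoms. Entailment
  -- thereby becomes a decidable truth-table check, and the interpolant a computed formula.
  Entailed : Rule → Set
  Entailed r = All (λ U → All (Any (Holds (_∈ U))) IF → RuleHolds (_∈ U) r) (sublists atomsF)

  holds? : ∀ U → Decidable (Holds (_∈ U))
  holds? U (lit true  p ts) = (p , ts) ∈ᵃ? U
  holds? U (lit false p ts) = ¬? ((p , ts) ∈ᵃ? U)

  headHolds? : ∀ U → Decidable (HeadHolds (_∈ U))
  headHolds? U nothing  = no id
  headHolds? U (just a) = a ∈ᵃ? U

  entailed? : Decidable Entailed
  entailed? (as , h) = All.all?
    (λ U → All.all? (Any.any? (holds? U)) IF →-dec (All.all? (_∈ᵃ? U) as →-dec headHolds? U h)) (sublists atomsF)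

  -- the atoms that may occur with sign s in the interpolant
  shared : Bool → List Atom
  shared s = filter (λ a → literal (not s) a ∈ˡ? concat IG) (filter (λ a → literal s a ∈ˡ? concat IF) atomsF)

  shared⁺ : ∀ s a → literal s a ∈ concat IF → literal (not s) a ∈ concat IG → a ∈ shared s
  shared⁺ s a mF mG = ∈-filter⁺ _ (∈-filter⁺ _ (∈-map⁺ atomOf mF) mF) mG

  shared⁻ : ∀ s {a} → a ∈ shared s → a ∈ atomsF × literal s a ∈ concat IF × literal (not s) a ∈ concat IG
  shared⁻ s m with m′ , mG ← ∈-filter⁻ (λ a → literal (not s) a ∈ˡ? concat IG) m
    with mA , mF ← ∈-filter⁻ (λ a → literal s a ∈ˡ? concat IF) m′ = mA , mF , mG

  rules : List Rule
  rules = filter entailed? (cartesianProduct (sublists (shared false)) (nothing ∷ map just (shared true)))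

  rules-premise : ∀ {as h a} → (as , h) ∈ rules → a ∈ as → a ∈ shared false
  rules-premise r∈ = sublists-⊆ (shared false)
    (proj₁ (∈-cartesianProduct⁻ (sublists (shared false)) _ (proj₁ (∈-filter⁻ entailed? r∈))))

  rules-head : ∀ {as a} → (as , just a) ∈ rules → a ∈ shared true
  rules-head r∈
    with there m ← proj₂ (∈-cartesianProduct⁻ (sublists (shared false)) _ (proj₁ (∈-filter⁻ entailed? r∈)))
    with _ , a∈ , refl ← ∈-map⁻ just m = a∈

  rules-entailed : ∀ {r} → r ∈ rules → Entailed r
  rules-entailed r∈ = proj₂ (∈-filter⁻ entailed? {xs = cartesianProduct (sublists (shared false)) _} r∈)

  module _ (em : ExcludedMiddle 0ℓ) where

    -- The restriction of v to `atomsF` is one of the lists that `Entailed` examines. It agrees with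
    -- v on `IF`, and all premises of rules lie in `atomsF`.
    rules-sound : ∀ v → Models v IF → ∀ r → r ∈ rules → RuleHolds v r
    rules-sound v v⊨IF (as , h) r∈ v⊨as = head h
      (All.lookup (rules-entailed r∈) (filter∈sublists v? atomsF)
        (All.tabulate U⊨IF)
        (All.tabulate (λ a∈ → ∈-filter⁺ v? (proj₁ (shared⁻ false (rules-premise r∈ a∈))) (All.lookup v⊨as a∈))))
      where
      v? : Decidable v
      v? _ = em
      U = filter v? atomsF
      U⊨IF : ∀ {C} → C ∈ IF → Any (Holds (_∈ U)) C
      U⊨IF {C} C∈ with L , L∈ , h ← find (v⊨IF C C∈) =
        lose L∈ (Holds-map L (∈-filter⁺ v? (∈-map⁺ atomOf (∈-concat⁺′ L∈ C∈)))
                             (proj₂ ∘ ∈-filter⁻ v? {xs = atomsF}) h)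
      head : ∀ h → HeadHolds (_∈ U) h → HeadHolds v h
      head (just a) a∈ = proj₂ (∈-filter⁻ v? {xs = atomsF} a∈)

    -- The consequences of IF and of the true shared premises form a model of IF, because IF is Horn.
    least-model : (∀ C → C ∈ IF → AtMostOnePositive C) → ∀ v → (∀ r → r ∈ rules → RuleHolds v r) →
      Σ (Atom → Set) λ w → Models w IF × (∀ a → a ∈ shared true → w a → v a) × (∀ a → a ∈ shared false → v a → w a)
    least-model horn v v⊨rules = w , w⊨IF , w⇒v , v⇒w
      where
      v? : Decidable v
      v? _ = em
      as : List Atom
      as = filter v? (shared false)
      as-true : All v as
      as-true = All.tabulate (proj₂ ∘ ∈-filter⁻ v? {xs = shared false})
      w : Atom → Set
      w a = Entailed (as , just a)
      -- Once entailed, the rule with premises `as` is listed in `rules`, and v makes all of `as`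
      -- true.
      fires : ∀ h → h ∈ nothing ∷ map just (shared true) → Entailed (as , h) → HeadHolds v h
      fires h h∈ ent = v⊨rules (as , h)
        (∈-filter⁺ entailed? (∈-cartesianProduct⁺ (filter∈sublists v? (shared false)) h∈) ent) as-true
      w⇒v : ∀ a → a ∈ shared true → w a → v a
      w⇒v a a∈ = fires (just a) (there (∈-map⁺ just a∈))
      v⇒w : ∀ a → a ∈ shared false → v a → w a
      v⇒w a a∈ va = All.tabulate (λ _ _ as⊆U → All.lookup as⊆U (∈-filter⁺ v? a∈ va))
      -- If w falsifies C, the atoms of its negative literals are entailed and so true in every U
      -- considered. Such a U must satisfy C by a positive literal, so a head that follows from each
      -- positive atom of C is entailed.
      entail : ∀ C → C ∈ IF → ¬ Any (Holds w) C → ∀ h →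
        (∀ a U → literal true a ∈ C → a ∈ U → HeadHolds (_∈ U) h) → Entailed (as , h)
      entail C C∈ ¬wC h toHead = All.tabulate λ {U} U∈ U⊨IF as⊆U →
        let L , L∈ , UL = find (All.lookup U⊨IF C∈) in go U U∈ U⊨IF as⊆U L L∈ UL
        where
        go : ∀ U → U ∈ sublists atomsF → All (Any (Holds (_∈ U))) IF → All (_∈ U) as →
          ∀ L → L ∈ C → Holds (_∈ U) L → HeadHolds (_∈ U) h
        go U U∈ U⊨IF as⊆U (lit true  p ts) L∈ a∈U = toHead (p , ts) U L∈ a∈U
        go U U∈ U⊨IF as⊆U (lit false p ts) L∈ a∉U =
          ⊥-elim (a∉U (All.lookup (decidable-stable em (λ ¬wa → ¬wC (lose L∈ ¬wa))) U∈ U⊨IF as⊆U))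
      w⊨IF : Models w IF
      w⊨IF C C∈ = decidable-stable em λ ¬wC → refute ¬wC em
        where
        refute : ¬ Any (Holds w) C → Dec (Σ Atom λ a → literal true a ∈ C) → ⊥
        -- The only positive atom of C is then itself entailed, hence true in w. With no positive
        -- atom, the rule without head would fire and contradict v.
        refute ¬wC (yes (a , a∈)) = ¬wC (lose a∈
          (entail C C∈ ¬wC (just a) (λ b U b∈ b∈U → subst (_∈ U) (horn C C∈ b a b∈ a∈) b∈U)))
        refute ¬wC (no none) =
          fires nothing (here refl) (entail C C∈ ¬wC nothing (λ b _ b∈ _ → none (b , b∈)))

-- Clause instances of a tableau, split by origin.

Inst : List CClause → Set
Inst S = Σ CClause λ C → C ∈ S × (ℕ → CTerm)

ground : ∀ {S} → Inst S → CClause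
ground (C , _ , σ) = map (instLit σ) C

module _ {SF SG : List CClause} where

  addInst : ∀ {C} → C ∈ SF ⊎ C ∈ SG → (ℕ → CTerm) → List (Inst SF) × List (Inst SG) → List (Inst SF) × List (Inst SG)
  addInst (inj₁ m) σ (is , js) = (_ , m , σ) ∷ is , js
  addInst (inj₂ m) σ (is , js) = is , (_ , m , σ) ∷ js

  instances : ∀ {br} → Tableau (SF ++ SG) br → List (Inst SF) × List (Inst SG)
  instancess : ∀ {br Ls} → All (λ L → Tableau (SF ++ SG) (L ∷ br)) Ls → List (Inst SF) × List (Inst SG)
  instances (close _) = [] , []
  instances (extend C C∈ σ Ts) = addInst (∈-++⁻ SF C∈) σ (instancess Ts)
  instancess [] = [] , []
  instancess (T ∷ Ts) =
    proj₁ (instances T) ++ proj₁ (instancess Ts) , proj₂ (instances T) ++ proj₂ (instancess Ts)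

  module _ (R : Literal → Set) (consistent : ∀ a → R (literal true a) → R (literal false a) → ⊥) where

    -- Descending at each node to a child in R leads to a closed branch inside R, against
    -- consistency. R is an arbitrary consistent set of literals because the application combines
    -- two valuations.
    closed-unsat : ∀ {br} (T : Tableau (SF ++ SG) br) →
      (∀ i → i ∈ proj₁ (instances T) → Any R (ground i)) → (∀ j → j ∈ proj₂ (instances T) → Any R (ground j)) →
      All R br → ⊥
    closed-unsats : ∀ {br Ls} (Ts : All (λ L → Tableau (SF ++ SG) (L ∷ br)) Ls) →
      (∀ i → i ∈ proj₁ (instancess Ts) → Any R (ground i)) → (∀ j → j ∈ proj₂ (instancess Ts) → Any R (ground j)) →
      Any R Ls → All R br → ⊥
    closed-unsat (close (p , ts , m , m′)) hF hG hbr = consistent (p , ts) (All.lookup hbr m) (All.lookup hbr m′)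
    closed-unsat (extend C C∈ σ Ts) hF hG hbr with ∈-++⁻ SF C∈
    ... | inj₁ m = closed-unsats Ts (λ i → hF i ∘ there) hG (hF _ (here refl)) hbr
    ... | inj₂ m = closed-unsats Ts hF (λ j → hG j ∘ there) (hG _ (here refl)) hbr
    closed-unsats (T ∷ Ts) hF hG (here r) hbr =
      closed-unsat T (λ i → hF i ∘ ∈-++⁺ˡ) (λ j → hG j ∘ ∈-++⁺ˡ) (r ∷ hbr)
    closed-unsats (T ∷ Ts) hF hG (there rs) hbr =
      closed-unsats Ts (λ i → hF i ∘ ∈-++⁺ʳ (proj₁ (instances T))) (λ j → hG j ∘ ∈-++⁺ʳ (proj₂ (instances T))) rs hbr

-- Replacing coloured terms by quantified variables

-- left (right) symbols are those to be eliminated in favour of existential (universal) quantifiers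
data Color : Set where
  common left right : Color

-- The arguments tell whether the symbol occurs on the side of F and on that of G. A symbol on
-- neither side may enter through substitutions of the tableau and is coloured `left`.
classify : Bool → Bool → Color
classify true  true  = common
classify false true  = right
classify _     false = left

classify-common : ∀ {P Q : Set} (p : Dec P) (q : Dec Q) → classify (does p) (does q) ≡ common → P × Q
classify-common (yes p) (yes q) eq = p , q
classify-common (yes p) (no ¬q) ()
classify-common (no ¬p) (yes q) ()
classify-common (no ¬p) (no ¬q) ()

-- The flag names a side: `false` is F and `true` is ¬G.
foreign : Color → Bool → Bool
foreign common b = false
foreign left   b = b
foreign right  b = not b

coloured? : (c : Color) → Dec (c ≢ common)
coloured? common = no (λ ne → ne refl)
coloured? left   = yes λ ()
coloured? right  = yes λ ()

-- Sorting terms by code, without repetitions.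

insert : CTerm → List CTerm → List CTerm
insert t [] = t ∷ []
insert t (s ∷ L) with <-cmp (code t) (code s)
... | tri< _ _ _ = t ∷ s ∷ L
... | tri≈ _ _ _ = s ∷ L
... | tri> _ _ _ = s ∷ insert t L

sort : List CTerm → List CTerm
sort = foldr insert []

Increasing : List CTerm → Set
Increasing = AllPairs (λ s t → code s < code t)

insert-All : ∀ {P : CTerm → Set} {t} L → P t → All P L → All P (insert t L)
insert-All [] p [] = p ∷ []
insert-All {t = t} (s ∷ L) p (q ∷ qs) with <-cmp (code t) (code s)
... | tri< _ _ _ = p ∷ q ∷ qs
... | tri≈ _ _ _ = q ∷ qs
... | tri> _ _ _ = q ∷ insert-All L p qs

insert-Increasing : ∀ t {L} → Increasing L → Increasing (insert t L)
insert-Increasing t {[]} [] = [] ∷ []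
insert-Increasing t {s ∷ L} (ls ∷ inc) with <-cmp (code t) (code s)
... | tri< t<s _ _ = (t<s ∷ All.map (<-trans t<s) ls) ∷ ls ∷ inc
... | tri≈ _ _ _ = ls ∷ inc
... | tri> _ _ s<t = insert-All L s<t ls ∷ insert-Increasing t inc

sort-Increasing : ∀ L → Increasing (sort L)
sort-Increasing []      = []
sort-Increasing (t ∷ L) = insert-Increasing t (sort-Increasing L)

sort-All : ∀ {P : CTerm → Set} {L} → All P L → All P (sort L)
sort-All [] = []
sort-All (p ∷ ps) = insert-All _ p (sort-All ps)

insert-self : ∀ t L → t ∈ insert t L
insert-self t [] = here refl
insert-self t (s ∷ L) with <-cmp (code t) (code s)
... | tri< _ _ _ = here refl
... | tri≈ _ eq _ = here (code-injective t s eq)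
... | tri> _ _ _ = there (insert-self t L)

insert-⊇ : ∀ {s} t L → s ∈ L → s ∈ insert t L
insert-⊇ t (u ∷ L) s∈ with <-cmp (code t) (code u) | s∈
... | tri< _ _ _ | _ = there s∈
... | tri≈ _ _ _ | _ = s∈
... | tri> _ _ _ | here eq = here eq
... | tri> _ _ _ | there m = there (insert-⊇ t L m)

∈-sort : ∀ {t} L → t ∈ L → t ∈ sort L
∈-sort (s ∷ L) (here refl) = insert-self s (sort L)
∈-sort (s ∷ L) (there t∈) = insert-⊇ s (sort L) (∈-sort L t∈)

module Lifting (SF SG : List Sym) (N : ℕ) where

  open DecMembership _≟ˢ_ using () renaming (_∈?_ to _∈ˢ?_)

  -- A clause variable surviving in an instance acts as an extra constant and is coloured `left`.
  -- Skolem symbols are never common.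
  color : Sym → Color
  color (cv n)        = left
  color (pa x)        = classify (does (pa x ∈ˢ? SF)) (does (pa x ∈ˢ? SG))
  color (fn (orig f)) = classify (does (fn (orig f) ∈ˢ? SF)) (does (fn (orig f) ∈ˢ? SG))
  color (fn (sk n))   = if does (fn (sk n) ∈ˢ? SF) then left else right

  -- Clause variables are exempt because instantiation replaces them.
  Own : Bool → Sym → Set
  Own b (cv n) = ⊤
  Own b r      = foreign (color r) b ≡ false

  SF-own : ∀ r → r ∈ SF → Own false r
  SF-own (cv n) m = tt
  SF-own (pa x) m with pa x ∈ˢ? SF | does (pa x ∈ˢ? SG)
  ... | yes _ | true  = refl
  ... | yes _ | false = refl
  ... | no ¬m | _     = ⊥-elim (¬m m)
  SF-own (fn (orig f)) m with fn (orig f) ∈ˢ? SF | does (fn (orig f) ∈ˢ? SG)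
  ... | yes _ | true  = refl
  ... | yes _ | false = refl
  ... | no ¬m | _     = ⊥-elim (¬m m)
  SF-own (fn (sk n)) m with fn (sk n) ∈ˢ? SF
  ... | yes _ = refl
  ... | no ¬m = ⊥-elim (¬m m)

  SG-own : (∀ n → fn (sk n) ∈ SF → fn (sk n) ∈ SG → ⊥) → ∀ r → r ∈ SG → Own true r
  SG-own apart (cv n) m = tt
  SG-own apart (pa x) m with does (pa x ∈ˢ? SF) | pa x ∈ˢ? SG
  ... | true  | yes _ = refl
  ... | false | yes _ = refl
  ... | _     | no ¬m = ⊥-elim (¬m m)
  SG-own apart (fn (orig f)) m with does (fn (orig f) ∈ˢ? SF) | fn (orig f) ∈ˢ? SG
  ... | true  | yes _ = refl
  ... | false | yes _ = refl
  ... | _     | no ¬m = ⊥-elim (¬m m)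
  SG-own apart (fn (sk n)) m with fn (sk n) ∈ˢ? SF
  ... | yes m′ = ⊥-elim (apart n m′ m)
  ... | no _   = refl

  color-common : ∀ r → color r ≡ common → r ∈ SF × r ∈ SG
  color-common (pa x) = classify-common (pa x ∈ˢ? SF) (pa x ∈ˢ? SG)
  color-common (fn (orig f)) = classify-common (fn (orig f) ∈ˢ? SF) (fn (orig f) ∈ˢ? SG)
  color-common (fn (sk n)) eq with does (fn (sk n) ∈ˢ? SF)
  color-common (fn (sk n)) () | true
  color-common (fn (sk n)) () | false

  -- The offset keeps these variables apart from the common free variables, which lie below N;
  -- distinct codes keep them apart from each other.
  name : CTerm → Var
  name t = N + code t

  ifCommon : Color → Term → Term → Term
  ifCommon common t u = t
  ifCommon _      t u = u

  mutual
    lift : CTerm → Term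
    lift t@(cvar n)           = var (name t)
    lift t@(param x)          = ifCommon (color (pa x)) (var x) (var (name t))
    lift t@(cfun (orig f) ts) = ifCommon (color (fn (orig f))) (fun f (lifts ts)) (var (name t))
    lift t@(cfun (sk n) ts)   = var (name t)

    lifts : List CTerm → List Term
    lifts []       = []
    lifts (t ∷ ts) = lift t ∷ lifts ts

  mutual
    lift-fun : ∀ {f} t → FunT f (lift t) → color (fn (orig f)) ≡ common
    lift-fun (param x) i with color (pa x)
    lift-fun (param x) () | common
    lift-fun (param x) () | left
    lift-fun (param x) () | right
    lift-fun (cfun (orig f) ts) i with color (fn (orig f)) in eq
    lift-fun (cfun (orig f) ts) here | common = eq
    lift-fun (cfun (orig f) ts) (arg i) | common = lifts-fun ts i
    lift-fun (cfun (orig f) ts) () | left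
    lift-fun (cfun (orig f) ts) () | right

    lifts-fun : ∀ {f} ts → Any (FunT f) (lifts ts) → color (fn (orig f)) ≡ common
    lifts-fun (t ∷ ts) (here i) = lift-fun t i
    lifts-fun (t ∷ ts) (there i) = lifts-fun ts i

  Covers : List CTerm → List CTerm → Set
  Covers L us = ∀ {s} → s ∈ us → color (root s) ≢ common → s ∈ L

  mutual
    lift-free : ∀ {L x} t → Covers L (subterms t) → FreeT x (lift t) →
      color (pa x) ≡ common ⊎ Σ CTerm λ s → s ∈ L × x ≡ name s
    lift-free (cvar n) cov here = inj₂ (_ , cov (here refl) (λ ()) , refl)
    -- The coverage fact is abstracted along with the colour, so that its premise becomes
    -- `left ≢ common` or `right ≢ common`, which is absurd to violate.
    lift-free (param x) cov i with color (pa x) in eq | cov (here refl)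
    lift-free (param x) cov here | common | _ = inj₁ eq
    lift-free (param x) cov here | left   | m = inj₂ (_ , m (λ ()) , refl)
    lift-free (param x) cov here | right  | m = inj₂ (_ , m (λ ()) , refl)
    lift-free (cfun (orig f) ts) cov i with color (fn (orig f)) | cov (here refl)
    lift-free (cfun (orig f) ts) cov (arg i) | common | _ = lifts-free ts (cov ∘ there) i
    lift-free (cfun (orig f) ts) cov here | left  | m = inj₂ (_ , m (λ ()) , refl)
    lift-free (cfun (orig f) ts) cov here | right | m = inj₂ (_ , m (λ ()) , refl)
    lift-free (cfun (sk n) ts) cov here with does (fn (sk n) ∈ˢ? SF) | cov (here refl)
    ... | true  | m = inj₂ (_ , m (λ ()) , refl)
    ... | false | m = inj₂ (_ , m (λ ()) , refl)

    lifts-free : ∀ {L x} ts → Covers L (subtermss ts) → Any (FreeT x) (lifts ts) →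
      color (pa x) ≡ common ⊎ Σ CTerm λ s → s ∈ L × x ≡ name s
    lifts-free (t ∷ ts) cov (here i) = lift-free t (cov ∘ ∈-++⁺ˡ) i
    lifts-free (t ∷ ts) cov (there i) = lifts-free ts (cov ∘ ∈-++⁺ʳ (subterms t)) i

  quantify : Color → Var → Formula → Formula
  quantify right x A = ∀' x A
  quantify _     x A = ∃' x A

  prefix : List CTerm → Formula → Formula
  prefix []      A = A
  prefix (t ∷ L) A = quantify (color (root t)) (name t) (prefix L A)

  prefix-IsHorn : ∀ L {A} → IsHorn A → IsHorn (prefix L A)
  prefix-IsHorn [] h = h
  prefix-IsHorn (t ∷ L) h with color (root t)
  ... | common = ex (prefix-IsHorn L h)
  ... | left   = ex (prefix-IsHorn L h)
  ... | right  = all (prefix-IsHorn L h)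

  prefix-fun : ∀ {f} L {A} → FunIn f (prefix L A) → FunIn f A
  prefix-fun [] i = i
  prefix-fun (t ∷ L) i with color (root t) | i
  ... | common | ex j  = prefix-fun L j
  ... | left   | ex j  = prefix-fun L j
  ... | right  | all j = prefix-fun L j

  prefix-pred : ∀ {p pol} L {A} → PredIn p pol (prefix L A) → PredIn p pol A
  prefix-pred [] i = i
  prefix-pred (t ∷ L) i with color (root t) | i
  ... | common | ex j  = prefix-pred L j
  ... | left   | ex j  = prefix-pred L j
  ... | right  | all j = prefix-pred L j

  prefix-free : ∀ {x} L {A} → FreeIn x (prefix L A) → FreeIn x A × (∀ {s} → s ∈ L → x ≢ name s)
  prefix-free [] i = i , λ ()
  prefix-free {x} (t ∷ L) {A} i with color (root t) | i
  ... | common | ex x≢ j  = proj₁ (prefix-free L j) , λ { (here refl) → x≢ ; (there m) → proj₂ (prefix-free L j) m }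
  ... | left   | ex x≢ j  = proj₁ (prefix-free L j) , λ { (here refl) → x≢ ; (there m) → proj₂ (prefix-free L j) m }
  ... | right  | all x≢ j = proj₁ (prefix-free L j) , λ { (here refl) → x≢ ; (there m) → proj₂ (prefix-free L j) m }

  -- Terms with a foreign root are opaque and get their value from δ; b = true makes left foreign.
  module Evaluation (M : Structure) (ρ : Var → Structure.D M) (skI : Semantics.SkInterp M) (b : Bool) where
    open Structure M
    open Semantics M

    mutual
      ev : (CTerm → D) → CTerm → D
      -- On the side of F any value will do for a surviving clause variable, since the clauses hold
      -- at every η.
      ev δ t@(cvar n)    = if foreign left b then δ t else elem
      ev δ t@(param x)   = if foreign (color (pa x)) b then δ t else ρ x
      ev δ t@(cfun f ts) = if foreign (color (fn f)) b then δ t else funInterp skI f (evs δ ts)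

      evs : (CTerm → D) → List CTerm → List D
      evs δ []       = []
      evs δ (t ∷ ts) = ev δ t ∷ evs δ ts

    evValuation : (CTerm → D) → Atom → Set
    evValuation δ (p , ts) = predI p (evs δ ts)

    mutual
      -- The symbols of a clause are its own, so opaque terms inside an instance stem from σ. An
      -- instance thus evaluates like the clause at η = `ev δ ∘ σ`, and it holds for every δ because
      -- the clause holds at every η.
      ev-subst : ∀ δ σ t → (∀ r → r ∈ symsT t → Own b r) →
        ev δ (substT σ t) ≡ evalI (interp ρ skI (ev δ ∘ σ)) t
      ev-subst δ σ (cvar n) own = refl
      ev-subst δ σ (param x) own rewrite own (pa x) (here refl) = refl
      ev-subst δ σ (cfun f ts) own rewrite own (fn f) (here refl) =
        cong (funInterp skI f) (evs-subst δ σ ts (λ r → own r ∘ there))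

      evs-subst : ∀ δ σ ts → (∀ r → r ∈ symsTs ts → Own b r) →
        evs δ (substTs σ ts) ≡ evalIs (interp ρ skI (ev δ ∘ σ)) ts
      evs-subst δ σ [] own = refl
      evs-subst δ σ (t ∷ ts) own =
        cong₂ _∷_ (ev-subst δ σ t (λ r → own r ∘ ∈-++⁺ˡ)) (evs-subst δ σ ts (λ r → own r ∘ ∈-++⁺ʳ (symsT t)))

    ev-Models : ∀ {S} → AllSyms (Own b) S → (∀ η → AllHold ρ skI η S) → ∀ δ (i : Inst S) →
      Any (Holds (evValuation δ)) (ground i)
    ev-Models own hold δ (C , C∈ , σ) with L , L∈ , hL ← find (hold (ev δ ∘ σ) C C∈) =
      lose (∈-map⁺ (instLit σ) L∈) (transfer L (λ r → own C∈ L∈) hL)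
      where
      transfer : ∀ L → (∀ r → r ∈ symsL L → Own b r) →
        Holds (valuation (interp ρ skI (ev δ ∘ σ))) L → Holds (evValuation δ) (instLit σ L)
      transfer (lit true  p ts) o h = subst (predI p) (sym (evs-subst δ σ ts o)) h
      transfer (lit false p ts) o h = h ∘ subst (predI p) (evs-subst δ σ ts o)

    assign : (CTerm → D) → CTerm → D → CTerm → D
    assign δ t d s with s ≟ᵗ t
    ... | yes _ = d
    ... | no _  = δ s

    assign-other : ∀ δ t d s → s ≢ t → assign δ t d s ≡ δ s
    assign-other δ t d s s≢t with s ≟ᵗ t
    ... | yes eq = ⊥-elim (s≢t eq)
    ... | no _   = refl

    ev-foreign : ∀ δ t → foreign (color (root t)) b ≡ true → ev δ t ≡ δ t
    ev-foreign δ (cvar n) eq rewrite eq = refl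
    ev-foreign δ (param x) eq rewrite eq = refl
    ev-foreign δ (cfun f ts) eq rewrite eq = refl

    ev-assign : ∀ δ t d → foreign (color (root t)) b ≡ true → ev (assign δ t d) t ≡ d
    ev-assign δ t d eq = trans (ev-foreign (assign δ t d) t eq) same
      where
      same : assign δ t d t ≡ d
      same with t ≟ᵗ t
      ... | yes _ = refl
      ... | no ne = ⊥-elim (ne refl)

    mutual
      -- `ev` consults δ only at subterms. Fixing the value of a newly quantified foreign term
      -- therefore leaves the terms quantified before it undisturbed.
      ev-local : ∀ δ t d s → t ∉ subterms s → ev (assign δ t d) s ≡ ev δ s
      ev-local δ t d (cvar n) t∉ rewrite assign-other δ t d (cvar n) (λ eq → t∉ (here (sym eq))) = refl
      ev-local δ t d (param x) t∉ rewrite assign-other δ t d (param x) (λ eq → t∉ (here (sym eq))) = refl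
      ev-local δ t d (cfun f ts) t∉
        rewrite assign-other δ t d (cfun f ts) (λ eq → t∉ (here (sym eq))) | evs-local δ t d ts (t∉ ∘ there) = refl

      evs-local : ∀ δ t d ss → t ∉ subtermss ss → evs (assign δ t d) ss ≡ evs δ ss
      evs-local δ t d [] t∉ = refl
      evs-local δ t d (s ∷ ss) t∉ =
        cong₂ _∷_ (ev-local δ t d s (t∉ ∘ ∈-++⁺ˡ)) (evs-local δ t d ss (t∉ ∘ ∈-++⁺ʳ (subterms s)))

    -- The invariant kept while passing through the quantifier prefix; L lists the terms whose
    -- quantifiers have been passed.
    record Matches (L : List CTerm) (δ : CTerm → D) (ρ′ : Var → D) : Set where
      field
        onNames : ∀ {s} → s ∈ L → ρ′ (name s) ≡ ev δ s
        onVars  : ∀ x → x < N → ρ′ x ≡ ρ x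

    open Matches

    module _ (common< : ∀ x → color (pa x) ≡ common → x < N) where
      mutual
        evalT-lift : ∀ {L δ ρ′} → Matches L δ ρ′ → ∀ t → Covers L (subterms t) → evalT M ρ′ (lift t) ≡ ev δ t
        evalT-lift m (cvar n) cov = onNames m (cov (here refl) (λ ()))
        evalT-lift {L} {δ} {ρ′} m (param x) cov
          with color (pa x) | common< x | (λ ne → onNames m (cov {param x} (here refl) ne))
        ... | common | <N | _  = onVars m x (<N refl)
        ... | left   | _  | eq = eq (λ ())
        ... | right  | _  | eq = eq (λ ())
        evalT-lift m (cfun (orig f) ts) cov
          with color (fn (orig f)) | (λ ne → onNames m (cov {cfun (orig f) ts} (here refl) ne))
        ... | common | _  = cong (funI f) (evalTs-lift m ts (cov ∘ there))
        ... | left   | eq = eq (λ ())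
        ... | right  | eq = eq (λ ())
        evalT-lift m (cfun (sk n) ts) cov = onNames m (cov (here refl) ne)
          where
          ne : color (fn (sk n)) ≢ common
          ne eq with does (fn (sk n) ∈ˢ? SF)
          ne () | true
          ne () | false

        evalTs-lift : ∀ {L δ ρ′} → Matches L δ ρ′ → ∀ ts → Covers L (subtermss ts) → evalTs M ρ′ (lifts ts) ≡ evs δ ts
        evalTs-lift m [] cov = refl
        evalTs-lift m (t ∷ ts) cov =
          cong₂ _∷_ (evalT-lift m t (cov ∘ ∈-++⁺ˡ)) (evalTs-lift m ts (cov ∘ ∈-++⁺ʳ (subterms t)))

    Matches-extend : ∀ {L δ ρ′ t} d δ′ → Matches L δ ρ′ → All (λ s → code s < code t) L →
      d ≡ ev δ′ t → (∀ {s} → s ∈ L → ev δ s ≡ ev δ′ s) → Matches (t ∷ L) δ′ (update M ρ′ (name t) d)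
    Matches-extend {L} {δ} {ρ′} {t} d δ′ m lt d≡ δ≡ = record
      { onNames = names
      ; onVars = λ x x<N → trans
          (override-other ρ′ d (<⇒≢ (<-≤-trans x<N (m≤m+n N (code t))))) (onVars m x x<N) }
      where
      names : ∀ {s} → s ∈ t ∷ L → update M ρ′ (name t) d (name s) ≡ ev δ′ s
      names (here refl) = trans (override-same ρ′ (name t) d) d≡
      names {s} (there s∈) = trans
        (override-other ρ′ d (λ eq → <⇒≢ (All.lookup lt s∈) (+-cancelˡ-≡ N _ _ eq)))
        (trans (onNames m s∈) (δ≡ s∈))

    Matches-own : ∀ {L δ ρ′ t} → Matches L δ ρ′ → All (λ s → code s < code t) L →
      Matches (t ∷ L) δ (update M ρ′ (name t) (ev δ t))
    Matches-own m lt = Matches-extend _ _ m lt refl (λ _ → refl)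

    Matches-foreign : ∀ {L δ ρ′ t} d → foreign (color (root t)) b ≡ true →
      Matches L δ ρ′ → All (λ s → code s < code t) L →
      Matches (t ∷ L) (assign δ t d) (update M ρ′ (name t) d)
    Matches-foreign {L} {δ} {ρ′} {t} d fo m lt = Matches-extend d (assign δ t d) m lt
      (sym (ev-assign δ t d fo))
      -- The code of t exceeds that of s, so t is no subterm of s.
      (λ {s} s∈ → sym (ev-local δ t d s (λ t∈ → <⇒≱ (All.lookup lt s∈) (code-subterm s t∈))))

  -- Passing through the quantifier prefix in a model.

  Above : List CTerm → List CTerm → Set
  Above done L = All (λ t → All (λ s → code s < code t) done) L

  Above-step : ∀ {done t L} → Above done L → All (λ u → code t < code u) L → Above (t ∷ done) L
  Above-step ab lt = All.zipWith (λ { (p , q) → q ∷ p }) (ab , lt)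

  module _ (M : Structure) (ρ : Var → Structure.D M) (skI : Semantics.SkInterp M) where

    module EF = Evaluation M ρ skI false
    module EG = Evaluation M ρ skI true

    -- For F, a left term has a value of its own, which serves as existential witness; the value
    -- given for a right term is recorded in δ. The matrix is handled for all δ, since δ changes on
    -- the way.
    prefix-intro : ∀ {A} done L → Increasing L → Above done L → All (λ t → color (root t) ≢ common) L →
      (∀ δ ρ′ → EF.Matches (L ʳ++ done) δ ρ′ → Sat M ρ′ A) →
      ∀ δ ρ′ → EF.Matches done δ ρ′ → Sat M ρ′ (prefix L A)
    prefix-intro done [] inc ab col k δ ρ′ m = k δ ρ′ m
    prefix-intro done (t ∷ L) (lt ∷ inc) (lt′ ∷ ab) (c ∷ col) k δ ρ′ m
      with color (root t) in eq
    ... | common = ⊥-elim (c refl)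
    ... | left = EF.ev δ t , prefix-intro (t ∷ done) L inc (Above-step ab lt) col k δ _ (EF.Matches-own m lt′)
    ... | right = λ d → prefix-intro (t ∷ done) L inc (Above-step ab lt) col k _ _
                    (EF.Matches-foreign d (cong (λ c → foreign c false) eq) m lt′)

    -- The dual for ¬G: the existential witness of a left term is recorded in δ, and a universal
    -- quantifier is instantiated with the value of the right term.
    prefix-elim : ∀ {A} done L → Increasing L → Above done L → All (λ t → color (root t) ≢ common) L →
      (∀ δ ρ′ → EG.Matches (L ʳ++ done) δ ρ′ → ¬ Sat M ρ′ A) →
      ∀ δ ρ′ → EG.Matches done δ ρ′ → ¬ Sat M ρ′ (prefix L A)
    prefix-elim done [] inc ab col k δ ρ′ m s = k δ ρ′ m s
    prefix-elim done (t ∷ L) (lt ∷ inc) (lt′ ∷ ab) (c ∷ col) k δ ρ′ m s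
      with color (root t) in eq
    ... | common = c refl
    ... | left = prefix-elim (t ∷ done) L inc (Above-step ab lt) col k _ _
                    (EG.Matches-foreign (proj₁ s) (cong (λ c → foreign c true) eq) m lt′) (proj₂ s)
    ... | right = prefix-elim (t ∷ done) L inc (Above-step ab lt) col k δ _ (EG.Matches-own m lt′) (s (EG.ev δ t))

-- The interpolant of a closed tableau

symVar : Sym → ℕ
symVar (pa x) = x
symVar _      = 0

∈⇒≤-max : ∀ {n} ns → n ∈ ns → n ≤ foldr _⊔_ 0 ns
∈⇒≤-max (m ∷ ns) (here refl) = m≤m⊔n m _
∈⇒≤-max (m ∷ ns) (there n∈) = ≤-trans (∈⇒≤-max ns n∈) (m≤n⊔m m _)

AtMostOnePositive-inst : ∀ σ {C} → AtMostOnePositive C → AtMostOnePositive (map (instLit σ) C)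
AtMostOnePositive-inst σ amo a b a∈ b∈
  with lit true p ts , L∈ , refl ← ∈-map⁻ (instLit σ) a∈
  with lit true q us , K∈ , refl ← ∈-map⁻ (instLit σ) b∈
  with refl ← amo (p , ts) (q , us) L∈ K∈ = refl

ground-literal : ∀ {S} (is : List (Inst S)) {s p ts} → lit s p ts ∈ concat (map ground is) →
  Σ CClause λ C → C ∈ S × Σ (List CTerm) λ ts′ → lit s p ts′ ∈ C
ground-literal is L∈
  with _ , L∈E , E∈ ← ∈-concat⁻′ (map ground is) L∈
  with (C , C∈ , σ) , _ , refl ← ∈-map⁻ ground E∈
  with lit _ _ ts′ , L′∈ , refl ← ∈-map⁻ (instLit σ) L∈E = C , C∈ , ts′ , L′∈

module Interpolation (cF cG : List CClause) (T : ClosedTableau (cF ++ cG)) where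

  IF IG : List CClause
  IF = map ground (proj₁ (instances {cF} {cG} T))
  IG = map ground (proj₂ (instances {cF} {cG} T))

  -- Exceeds every parameter of `cF`, hence every common one; other symbols contribute 0 to the
  -- maximum.
  bound : ℕ
  bound = suc (foldr _⊔_ 0 (map symVar (symsS cF)))

  open HornRules IF IG
  open Lifting (symsS cF) (symsS cG) bound

  liftAtom : Atom → Formula
  liftAtom (p , ts) = atom p (lifts ts)

  -- The implication is spelled out as a disjunction of literals ending in the head or in `⊥'`, as
  -- `Clause` demands.
  ruleFormula : List Atom → Maybe Atom → Formula
  ruleFormula []       nothing  = ⊥'
  ruleFormula []       (just a) = liftAtom a
  ruleFormula (a ∷ as) h        = (¬' liftAtom a) ∨' ruleFormula as h

  matrix : List Rule → Formula
  matrix []             = ⊤'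
  matrix ((as , h) ∷ rs) = ruleFormula as h ∧' matrix rs

  sharedTerms : List CTerm
  sharedTerms = concatMap (subtermss ∘ proj₂) (shared false ++ shared true)

  coloured : List CTerm
  coloured = sort (filter (coloured? ∘ color ∘ root) sharedTerms)

  interpolant : Formula
  interpolant = prefix coloured (matrix rules)

  ruleFormula-Horn : ∀ as h → HornClause (ruleFormula as h)
  ruleFormula-Horn [] nothing = 0 , empty , z≤n
  ruleFormula-Horn [] (just a) = 1 , posL , ≤-refl
  ruleFormula-Horn (a ∷ as) h with n , c , n≤1 ← ruleFormula-Horn as h = n , disj negL c , n≤1

  matrix-IsHorn : ∀ rs → IsHorn (matrix rs)
  matrix-IsHorn []              = truth
  matrix-IsHorn ((as , h) ∷ rs) = conj (clause (ruleFormula-Horn as h)) (matrix-IsHorn rs)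

  interpolant-IsHorn : IsHorn interpolant
  interpolant-IsHorn = prefix-IsHorn coloured (matrix-IsHorn rules)

  shared-covered : ∀ s {p ts} → (p , ts) ∈ shared s → Covers coloured (subtermss ts)
  shared-covered s a∈ t∈ col = ∈-sort _ (∈-filter⁺ (coloured? ∘ color ∘ root)
    (∈-concatMap⁺ (subtermss ∘ proj₂) (lose (either s a∈) t∈)) col)
    where
    either : ∀ s {a} → a ∈ shared s → a ∈ shared false ++ shared true
    either false m = ∈-++⁺ˡ m
    either true  m = ∈-++⁺ʳ (shared false) m

  coloured-Increasing : Increasing coloured
  coloured-Increasing = sort-Increasing (filter (coloured? ∘ color ∘ root) sharedTerms)

  coloured-All : All (λ t → color (root t) ≢ common) coloured
  coloured-All = sort-All (Allₚ.all-filter (coloured? ∘ color ∘ root) sharedTerms)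

  record RuleShared (as : List Atom) (h : Maybe Atom) : Set where
    field
      premise : ∀ {a} → a ∈ as → a ∈ shared false
      head    : ∀ {a} → h ≡ just a → a ∈ shared true

  open RuleShared

  RuleShared-tail : ∀ {a as h} → RuleShared (a ∷ as) h → RuleShared as h
  RuleShared-tail sh = record { premise = premise sh ∘ there ; head = head sh }

  rules-shared : ∀ {as h} → (as , h) ∈ rules → RuleShared as h
  rules-shared r∈ = record { premise = rules-premise r∈ ; head = λ { refl → rules-head r∈ } }

  rule-pred : ∀ {p pol} as h → RuleShared as h → PredIn p pol (ruleFormula as h) →
    Σ Bool λ s → pol ≡ signPol s × Σ (List CTerm) λ ts → (p , ts) ∈ shared s
  rule-pred [] (just (p , ts)) sh atm = true , refl , ts , head sh refl
  rule-pred ((p , ts) ∷ as) h sh (orl (neg atm)) = false , refl , ts , premise sh (here refl)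
  rule-pred (a ∷ as) h sh (orr i) = rule-pred as h (RuleShared-tail sh) i

  rule-fun : ∀ {f} as h → FunIn f (ruleFormula as h) → color (fn (orig f)) ≡ common
  rule-fun [] (just (p , ts)) (atm i) = lifts-fun ts i
  rule-fun ((p , ts) ∷ as) h (orl (neg (atm i))) = lifts-fun ts i
  rule-fun (a ∷ as) h (orr i) = rule-fun as h i

  rule-free : ∀ {x} as h → RuleShared as h → FreeIn x (ruleFormula as h) →
    color (pa x) ≡ common ⊎ Σ CTerm λ s → s ∈ coloured × x ≡ name s
  rule-free [] (just (p , ts)) sh (atm i) = lifts-free ts (shared-covered true (head sh refl)) i
  rule-free ((p , ts) ∷ as) h sh (orl (neg (atm i))) =
    lifts-free ts (shared-covered false (premise sh (here refl))) i
  rule-free (a ∷ as) h sh (orr i) = rule-free as h (RuleShared-tail sh) i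

  matrix-pred : ∀ {p pol} rs → (∀ {r} → r ∈ rs → r ∈ rules) → PredIn p pol (matrix rs) →
    Σ Bool λ s → pol ≡ signPol s × Σ (List CTerm) λ ts → (p , ts) ∈ shared s
  matrix-pred ((as , h) ∷ rs) ⊆ (andl i) = rule-pred as h (rules-shared (⊆ (here refl))) i
  matrix-pred (_ ∷ rs) ⊆ (andr i) = matrix-pred rs (⊆ ∘ there) i

  matrix-fun : ∀ {f} rs → FunIn f (matrix rs) → color (fn (orig f)) ≡ common
  matrix-fun ((as , h) ∷ rs) (andl i) = rule-fun as h i
  matrix-fun (_ ∷ rs) (andr i) = matrix-fun rs i

  matrix-free : ∀ {x} rs → (∀ {r} → r ∈ rs → r ∈ rules) → FreeIn x (matrix rs) →
    color (pa x) ≡ common ⊎ Σ CTerm λ s → s ∈ coloured × x ≡ name s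
  matrix-free ((as , h) ∷ rs) ⊆ (andl i) = rule-free as h (rules-shared (⊆ (here refl))) i
  matrix-free (_ ∷ rs) ⊆ (andr i) = matrix-free rs (⊆ ∘ there) i

  -- An atom in `shared s` comes with a literal of an instance on each side, and instantiation
  -- preserves sign and predicate.
  interpolant-pred : ∀ {p pol} → PredIn p pol interpolant →
    Σ Bool λ s → pol ≡ signPol s ×
      (Σ CClause λ C → C ∈ cF × Σ (List CTerm) λ ts → lit s p ts ∈ C) ×
      (Σ CClause λ C → C ∈ cG × Σ (List CTerm) λ ts → lit (not s) p ts ∈ C)
  interpolant-pred i with s , eq , ts , a∈ ← matrix-pred rules id (prefix-pred coloured i)
    with _ , mF , mG ← shared⁻ s a∈ =
    s , eq , ground-literal (proj₁ (instances {cF} {cG} T)) mF , ground-literal (proj₂ (instances {cF} {cG} T)) mG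

  interpolant-fun : ∀ {f} → FunIn f interpolant → fn (orig f) ∈ symsS cF × fn (orig f) ∈ symsS cG
  interpolant-fun i = color-common _ (matrix-fun rules (prefix-fun coloured i))

  interpolant-free : ∀ {x} → FreeIn x interpolant → pa x ∈ symsS cF × pa x ∈ symsS cG
  interpolant-free i with j , notBound ← prefix-free coloured i with matrix-free rules id j
  ... | inj₁ eq = color-common _ eq
  ... | inj₂ (s , s∈ , eq) = ⊥-elim (notBound s∈ eq)

  common<bound : ∀ x → color (pa x) ≡ common → x < bound
  common<bound x eq = s≤s (∈⇒≤-max _ (∈-map⁺ symVar (proj₁ (color-common (pa x) eq))))

  module _ (em : ExcludedMiddle 0ℓ) (M : Structure) where
    open Structure M
    open Semantics M

    Decodes : (Var → D) → (Atom → Set) → Set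
    Decodes ρ′ v = ∀ s a → a ∈ shared s → (Sat M ρ′ (liftAtom a) → v a) × (v a → Sat M ρ′ (liftAtom a))

    Sat-rule⁺ : ∀ {ρ′ v} → Decodes ρ′ v → ∀ as h → RuleShared as h → RuleHolds v (as , h) → Sat M ρ′ (ruleFormula as h)
    Sat-rule⁺ dec [] nothing sh r = r []
    Sat-rule⁺ dec [] (just a) sh r = proj₂ (dec true a (head sh refl)) (r [])
    Sat-rule⁺ {v = v} dec (a ∷ as) h sh r with em {P = v a}
    ... | yes va = inj₂ (Sat-rule⁺ dec as h (RuleShared-tail sh) (λ vas → r (va ∷ vas)))
    ... | no ¬va = inj₁ (¬va ∘ proj₁ (dec false a (premise sh (here refl))))

    Sat-rule⁻ : ∀ {ρ′ v} → Decodes ρ′ v → ∀ as h → RuleShared as h → Sat M ρ′ (ruleFormula as h) → RuleHolds v (as , h)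
    Sat-rule⁻ dec [] (just a) sh s [] = proj₁ (dec true a (head sh refl)) s
    Sat-rule⁻ dec (a ∷ as) h sh (inj₁ ¬s) (va ∷ vas) = ⊥-elim (¬s (proj₂ (dec false a (premise sh (here refl))) va))
    Sat-rule⁻ dec (a ∷ as) h sh (inj₂ s) (va ∷ vas) = Sat-rule⁻ dec as h (RuleShared-tail sh) s vas

    Sat-matrix⁺ : ∀ {ρ′} rs → (∀ {as h} → (as , h) ∈ rs → Sat M ρ′ (ruleFormula as h)) → Sat M ρ′ (matrix rs)
    Sat-matrix⁺ [] k = tt
    Sat-matrix⁺ (r ∷ rs) k = k (here refl) , Sat-matrix⁺ rs (k ∘ there)

    Sat-matrix⁻ : ∀ {ρ′} rs → Sat M ρ′ (matrix rs) → ∀ {as h} → (as , h) ∈ rs → Sat M ρ′ (ruleFormula as h)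
    Sat-matrix⁻ (r ∷ rs) (s , _) (here refl) = s
    Sat-matrix⁻ (r ∷ rs) (_ , s) (there r∈) = Sat-matrix⁻ rs s r∈

    module _ (ρ : Var → D) (skI : SkInterp) where

      Decodes-Matches : ∀ b → let open Evaluation M ρ skI b in
        ∀ {δ ρ′} → Matches (coloured ʳ++ []) δ ρ′ → Decodes ρ′ (evValuation δ)
      Decodes-Matches b {δ} m s (p , ts) a∈ = subst (predI p) eq , subst (predI p) (sym eq)
        where
        open Evaluation M ρ skI b
        -- Passing through the prefix has collected its terms in reverse.
        eq = evalTs-lift common<bound m ts (λ t∈ col → Anyₚ.reverse⁺ (shared-covered s a∈ t∈ col))

      Matches-[] : ∀ b → let open Evaluation M ρ skI b in ∀ δ → Matches [] δ ρ
      Matches-[] b δ = record { onNames = λ () ; onVars = λ _ _ → refl }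

      Above-[] : ∀ L → Above [] L
      Above-[] L = All.tabulate (λ _ → [])

      interpolant-holds : (∀ η → AllHold ρ skI η cF) → Sat M ρ interpolant
      interpolant-holds hold = prefix-intro M ρ skI [] coloured coloured-Increasing (Above-[] coloured) coloured-All
        (λ δ ρ′ m → Sat-matrix⁺ rules (λ {as} {h} r∈ →
          Sat-rule⁺ (Decodes-Matches false m) as h (rules-shared r∈)
            (rules-sound em (evValuation δ) (models δ) (as , h) r∈)))
        -- The initial δ is arbitrary, because `models` holds for every δ.
        (λ _ → elem) ρ (Matches-[] false _)
        where
        open Evaluation M ρ skI false
        models : ∀ δ → Models (evValuation δ) IF
        models δ C C∈ with i , _ , refl ← ∈-map⁻ ground C∈ =
          ev-Models (λ C∈ L∈ r∈ → SF-own _ (symsS⁺ C∈ L∈ r∈)) hold δ i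

      interpolant-refutes : (∀ n → fn (sk n) ∈ symsS cF → fn (sk n) ∈ symsS cG → ⊥) →
        (∀ C → C ∈ cF → AtMostOnePositive C) → (∀ η → AllHold ρ skI η cG) → ¬ Sat M ρ interpolant
      interpolant-refutes apart horn hold =
        prefix-elim M ρ skI [] coloured coloured-Increasing (Above-[] coloured) coloured-All
          contradictory (λ _ → elem) ρ (Matches-[] true _)
        where
        open Evaluation M ρ skI true
        hornIF : ∀ C → C ∈ IF → AtMostOnePositive C
        hornIF C C∈ with (C′ , C′∈ , σ) , _ , refl ← ∈-map⁻ ground C∈ = AtMostOnePositive-inst σ (horn C′ C′∈)
        contradictory : ∀ δ ρ′ → Matches (coloured ʳ++ []) δ ρ′ → ¬ Sat M ρ′ (matrix rules)
        contradictory δ ρ′ m s =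
          let w , w⊨IF , w⇒v , v⇒w = least-model em hornIF v (λ { (as , h) r∈ →
                Sat-rule⁻ (Decodes-Matches true m) as h (rules-shared r∈) (Sat-matrix⁻ rules s r∈) })
          in refute w w⊨IF w⇒v v⇒w
          where
          v = evValuation δ
          refute : ∀ w → Models w IF → (∀ a → a ∈ shared true → w a → v a) → (∀ a → a ∈ shared false → v a → w a) → ⊥
          refute w w⊨IF w⇒v v⇒w = closed-unsat True consistent T onF onG []
            where
            True : Literal → Set
            -- Remembering where a literal occurs puts the atom of a clash between the two sides
            -- into `shared true` or `shared false`, where v and w are comparable.
            True L = (L ∈ concat IF × Holds w L) ⊎ (L ∈ concat IG × Holds v L)
            consistent : ∀ a → True (literal true a) → True (literal false a) → ⊥
            consistent a (inj₁ (_ , wa)) (inj₁ (_ , ¬wa)) = ¬wa wa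
            consistent a (inj₁ (m , wa)) (inj₂ (m′ , ¬va)) = ¬va (w⇒v a (shared⁺ true a m m′) wa)
            consistent a (inj₂ (m , va)) (inj₁ (m′ , ¬wa)) = ¬wa (v⇒w a (shared⁺ false a m′ m) va)
            consistent a (inj₂ (_ , va)) (inj₂ (_ , ¬va)) = ¬va va
            onF : ∀ i → i ∈ proj₁ (instances {cF} {cG} T) → Any True (ground i)
            onF i i∈ with L , L∈ , h ← find (w⊨IF (ground i) (∈-map⁺ ground i∈)) =
              lose L∈ (inj₁ (∈-concat⁺′ L∈ (∈-map⁺ ground i∈) , h))
            onG : ∀ j → j ∈ proj₂ (instances {cF} {cG} T) → Any True (ground j)
            onG j j∈ with L , L∈ , h ← find (ev-Models (λ C∈ L∈ r∈ → SG-own apart _ (symsS⁺ C∈ L∈ r∈)) hold δ j) =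
              lose L∈ (inj₂ (∈-concat⁺′ L∈ (∈-map⁺ ground j∈) , h))

-- Clausal forms of Horn formulas

positives : CClause → ℕ
positives []                 = 0
positives (lit true  _ _ ∷ C) = suc (positives C)
positives (lit false _ _ ∷ C) = positives C

positives-++ : ∀ C D → positives (C ++ D) ≡ positives C + positives D
positives-++ [] D = refl
positives-++ (lit true  _ _ ∷ C) D = cong suc (positives-++ C D)
positives-++ (lit false _ _ ∷ C) D = positives-++ C D

positives-∈ : ∀ {a} C → literal true a ∈ C → 1 ≤ positives C
positives-∈ (lit true  _ _ ∷ C) _ = s≤s z≤n
positives-∈ (lit false _ _ ∷ C) (there m) = positives-∈ C m

positives≤1 : ∀ C → positives C ≤ 1 → AtMostOnePositive C
positives≤1 (lit true  p ts ∷ C) le a b (here refl) (here refl) = refl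
positives≤1 (lit true  p ts ∷ C) le a b (here refl) (there m) = ⊥-elim (<⇒≱ (s≤s (positives-∈ C m)) le)
positives≤1 (lit true  p ts ∷ C) le a b (there m) _ = ⊥-elim (<⇒≱ (s≤s (positives-∈ C m)) le)
positives≤1 (lit false p ts ∷ C) le a b (there m) (there m′) = positives≤1 C le a b m m′

-- Each disjunct yields a single clause, so `cross` yields a single one as well, and the numbers of
-- positive literals add up as the indices do.
clauses-Clause : ∀ {A n} → Clause A n → ∀ e us c →
  Σ CClause λ C → clauses e us c A ≡ C ∷ [] × positives C ≡ n
clauses-Clause empty e us c = [] , refl , refl
clauses-Clause posL e us c = _ , refl , refl
clauses-Clause negL e us c = _ , refl , refl
clauses-Clause (disj {A} a b) e us c
  with C , eqC , refl ← clauses-Clause a e us c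
  with D , eqD , refl ← clauses-Clause b e us (counter e us c A) =
  C ++ D , cong₂ cross eqC eqD , positives-++ C D

-- Above the Horn clauses there are only conjunctions and quantifiers, which collect clauses or
-- change their terms but never join two of them.
clauses-Horn : ∀ {F} → IsHorn F → ∀ e us c C → C ∈ clauses e us c F → AtMostOnePositive C
clauses-Horn (clause (n , cls , n≤1)) e us c C C∈
  with D , eq , refl ← clauses-Clause cls e us c
  with here refl ← subst (C ∈_) eq C∈ = positives≤1 D n≤1
clauses-Horn (conj {A} a b) e us c C C∈ with ∈-++⁻ (clauses e us c A) C∈
... | inj₁ m = clauses-Horn a e us c C m
... | inj₂ m = clauses-Horn b e us _ C m
clauses-Horn (all a) e us c C C∈ = clauses-Horn a _ _ _ C C∈
clauses-Horn (ex a) e us c C C∈ = clauses-Horn a _ _ _ C C∈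

-- Clausal forms of F and ¬G in terms of the original formulas.

Origin : Formula → ℕ → ℕ → Sym → Set
Origin A lo hi (cv n)        = ⊤
Origin A lo hi (pa x)        = FreeIn x A
Origin A lo hi (fn (orig f)) = FunIn f A
Origin A lo hi (fn (sk n))   = lo ≤ n × n < hi

module _ (b : Bool) (A : Formula) (c : ℕ) where

  signedClauses : List CClause
  signedClauses = proj₁ (cl param [] c b A)

  signed-origin : ∀ {r} → r ∈ symsS signedClauses → Origin A c (proj₂ (cl param [] c b A)) r
  signed-origin {r} r∈ rewrite cl-nnf b A param [] c
    with C , C∈ , L , L∈ , r∈L ← symsS⁻ (clauses param [] c (nnf b A)) r∈ =
    clauses-syms {Origin A c _} (nnf-NNF b A) param [] c record
      { ofFun = λ f → FunIn-nnf b A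
      ; ofFresh = λ n l u → tt , l , u
      ; ofEnv = λ { x i r (here refl) → FreeIn-nnf b A i }
      ; ofScope = λ _ () } C∈ L∈ r∈L

  signed-pred : ∀ {C s p ts} → C ∈ signedClauses → lit s p ts ∈ C → PredIn p (flipUnless b (signPol s)) A
  signed-pred C∈ L∈ rewrite cl-nnf b A param [] c =
    PredIn-nnf b A (clauses-preds (nnf-NNF b A) param [] c C∈ L∈)

  signed-skolemize : ExcludedMiddle 0ℓ → ∀ M ρ → SatSign M b ρ A →
    Σ (Semantics.SkInterp M) λ skI → ∀ η → Semantics.AllHold M ρ skI η signedClauses
  signed-skolemize em M ρ s rewrite cl-nnf b A param [] c =
    let skI , _ , hold = Semantics.skolemize M ρ em (nnf-NNF b A) param [] c (WellScoped-param c)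
                           -- Skolem symbols start from an arbitrary interpretation. The guard is
                           -- trivial because at the outset every η induces the assignment ρ.
                           (λ _ _ → Structure.elem M) (λ _ → ⊤) (λ _ _ → Sat-nnf⁺ em M b A s)
    in skI , λ η → hold η tt

-- Assembling the interpolant of F and G.

module Construction (F G : Formula) (T : TableauProof F G) where

  fresh : ℕ
  fresh = counter param [] 0 F

  -- `clausalForm F G` unfolds to the concatenation of these two lists, with the counter for ¬G
  -- starting where that for F stops.
  open Interpolation (signedClauses true F 0) (signedClauses false G fresh) T public

  -- Skolem numbers of F lie below `fresh`, those of ¬G do not.
  skolems-apart : ∀ n → fn (sk n) ∈ symsS (signedClauses true F 0) →
    fn (sk n) ∈ symsS (signedClauses false G fresh) → ⊥
  skolems-apart n mF mG = <⇒≱ (proj₂ (signed-origin true F 0 mF)) (proj₁ (signed-origin false G fresh mG))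

  interpolant-Interpolant : ExcludedMiddle 0ℓ → IsHorn F → Interpolant F G interpolant
  interpolant-Interpolant em horn = record
    { F⊨H = λ M ρ s →
        let skI , hold = signed-skolemize true F 0 em M ρ s in interpolant-holds em M ρ skI hold
    ; H⊨G = λ M ρ s → decidable-stable em λ ¬g →
        let skI , hold = signed-skolemize false G fresh em M ρ ¬g
        in interpolant-refutes em M ρ skI skolems-apart (clauses-Horn horn param [] 0) hold s
    ; funs = λ f i → let mF , mG = interpolant-fun i in
        signed-origin true F 0 mF , signed-origin false G fresh mG
    ; preds = λ p pol i → polarities (interpolant-pred i)
    ; vars = λ x i → let mF , mG = interpolant-free i in
        signed-origin true F 0 mF , signed-origin false G fresh mG }
    where
    polarities : ∀ {p pol} →
      (Σ Bool λ s → pol ≡ signPol s ×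
        (Σ CClause λ C → C ∈ signedClauses true F 0 × Σ (List CTerm) λ ts → lit s p ts ∈ C) ×
        (Σ CClause λ C → C ∈ signedClauses false G fresh × Σ (List CTerm) λ ts → lit (not s) p ts ∈ C)) →
      PredIn p pol F × PredIn p pol G
    -- With s known, the polarity in G, flipped once by the negated literal and once by ¬G, computes
    -- to that in F.
    polarities (true  , refl , (_ , CF∈ , _ , LF∈) , (_ , CG∈ , _ , LG∈)) =
      signed-pred true F 0 CF∈ LF∈ , signed-pred false G fresh CG∈ LG∈
    polarities (false , refl , (_ , CF∈ , _ , LF∈) , (_ , CG∈ , _ , LG∈)) =
      signed-pred true F 0 CF∈ LF∈ , signed-pred false G fresh CG∈ LG∈

theorem2 : Σ ((F G : Formula) → TableauProof F G → Formula) λ construct →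
    ExcludedMiddle 0ℓ →
    ((F G : Formula) → IsHorn F → F ⊨ G →
    Σ Formula λ H → IsHorn H × Interpolant F G H)
    × ((F G : Formula) (T : TableauProof F G) → IsHorn F →
    IsHorn (construct F G T) × Interpolant F G (construct F G T))
-- The construction is a function of the tableau proof; excluded middle enters in its verification
-- and in the existence of a tableau.
theorem2 = Construction.interpolant , λ em →
  (λ F G horn F⊨G → let open Construction F G (tableau-complete em F G F⊨G) in
    interpolant , interpolant-IsHorn , interpolant-Interpolant em horn) ,
  (λ F G T horn → let open Construction F G T in
    interpolant-IsHorn , interpolant-Interpolant em horn)
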